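{- Let $k\geq 1$ be an integer and let $G$ be a graph of order $n$. If \[ \mu(G)>\frac{k}{2}+\sqrt{kn+\frac{k^2-4k}{4}}, \] then $G$ contains the cycle $C_{2l+2}$ as a subgraph for every $l=1,\ldots,k$.
   Context: All graphs are finite and simple. $\mu(G)$ denotes the largest eigenvalue of the adjacency matrix of $G$. $C_r$ denotes the cycle on $r$ vertices. -}

module Defs where

open import Algebra.Bundles.Raw using (RawMonoid)
import Algebra.Definitions.RawMonoid as RawMonoidDefs
open import Data.Bool.Base using (if_then_else_)
open import Data.Fin.Base using (Fin; toℕ)
import Data.Fin.Properties as Fin
open import Data.Nat.Base as ℕ using (ℕ; suc)
import Data.Nat.Properties as ℕ
open import Data.Product.Base using (∃; _×_; _,_; proj₁; proj₂)
open import Data.Rational.Base as ℚ using (ℚ; 0ℚ; 1ℚ; ½; ∣_∣; Positive; NonNegative; 1/_)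
import Data.Rational.Properties as ℚ
open import Data.Rational.Solver using (module +-*-Solver)
open import Data.Sum.Base using (_⊎_; swap)
open import Data.Vec.Functional using (Vector)
open import Function.Base using (_∘_)
open import Function.Definitions using (Injective)
open import Level using (0ℓ)
open import Relation.Binary.Core using (Rel)
open import Relation.Binary.Definitions using (Decidable; Irreflexive; Symmetric)
open import Relation.Binary.PropositionalEquality using (_≡_; _≢_; refl; sym; cong; subst; module ≡-Reasoning)
open import Relation.Nullary using (¬_; does; ¬?; _×-dec_; _⊎-dec_)

IsCauchy : (ℕ → ℚ) → Set
IsCauchy x = ∀ ε → 0ℚ ℚ.< ε →
  ∃ λ N → ∀ m n → N ℕ.≤ m → N ℕ.≤ n → ∣ x m ℚ.- x n ∣ ℚ.≤ ε

-- The reals as Cauchy sequences of rationals; equality of reals is _≈_, not _≡_.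
record ℝ : Set where
  constructor mkℝ
  field
    seq    : ℕ → ℚ
    cauchy : IsCauchy seq

open ℝ public

infix 4 _≈_ _<_ _≤_ _>_

_≈_ : Rel ℝ 0ℓ
x ≈ y = ∀ ε → 0ℚ ℚ.< ε → ∃ λ N → ∀ n → N ℕ.≤ n → ∣ seq x n ℚ.- seq y n ∣ ℚ.≤ ε

_<_ : Rel ℝ 0ℓ
x < y = ∃ λ ε → 0ℚ ℚ.< ε × ∃ λ N → ∀ n → N ℕ.≤ n → seq x n ℚ.+ ε ℚ.≤ seq y n

_>_ : Rel ℝ 0ℓ
x > y = y < x

_≤_ : Rel ℝ 0ℓ
x ≤ y = ¬ (y < x)

fromℚ : ℚ → ℝ
fromℚ q = mkℝ (λ _ → q) λ ε 0<ε → 0 , λ _ _ _ _ →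
  subst (ℚ._≤ ε) (sym (cong ∣_∣ (ℚ.+-inverseʳ q))) (ℚ.<⇒≤ 0<ε)

0ℝ : ℝ
0ℝ = fromℚ 0ℚ

1ℝ : ℝ
1ℝ = fromℚ 1ℚ

private
  open +-*-Solver using (solve; _:=_; _:+_; _:*_; _:-_)

  +-diff : ∀ a b c d → (a ℚ.+ b) ℚ.- (c ℚ.+ d) ≡ (a ℚ.- c) ℚ.+ (b ℚ.- d)
  +-diff = solve 4 (λ a b c d → (a :+ b) :- (c :+ d) := (a :- c) :+ (b :- d)) refl

  *-diff : ∀ a b c d → a ℚ.* b ℚ.- c ℚ.* d ≡ a ℚ.* (b ℚ.- d) ℚ.+ d ℚ.* (a ℚ.- c)
  *-diff = solve 4 (λ a b c d → a :* b :- c :* d := a :* (b :- d) :+ d :* (a :- c)) refl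

  diff-+ : ∀ a b → a ≡ (a ℚ.- b) ℚ.+ b
  diff-+ = solve 2 (λ a b → a := (a :- b) :+ b) refl

  +-cauchy : ∀ {x y} → IsCauchy x → IsCauchy y → IsCauchy (λ n → x n ℚ.+ y n)
  +-cauchy {x} {y} cx cy ε 0<ε = M ℕ.⊔ N , λ m n p q → begin
      ∣ (x m ℚ.+ y m) ℚ.- (x n ℚ.+ y n) ∣
        ≡⟨ cong ∣_∣ (+-diff (x m) (y m) (x n) (y n)) ⟩
      ∣ (x m ℚ.- x n) ℚ.+ (y m ℚ.- y n) ∣
        ≤⟨ ℚ.∣p+q∣≤∣p∣+∣q∣ (x m ℚ.- x n) (y m ℚ.- y n) ⟩
      ∣ x m ℚ.- x n ∣ ℚ.+ ∣ y m ℚ.- y n ∣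
        ≤⟨ ℚ.+-mono-≤ (hx m n (ℕ.m⊔n≤o⇒m≤o M N p) (ℕ.m⊔n≤o⇒m≤o M N q))
                      (hy m n (ℕ.m⊔n≤o⇒n≤o M N p) (ℕ.m⊔n≤o⇒n≤o M N q)) ⟩
      ½ ℚ.* ε ℚ.+ ½ ℚ.* ε
        ≡⟨ ℚ.*-distribʳ-+ ε ½ ½ ⟨
      1ℚ ℚ.* ε
        ≡⟨ ℚ.*-identityˡ ε ⟩
      ε ∎
    where
    open ℚ.≤-Reasoning
    instance
      ε⁺ : Positive ε
      ε⁺ = ℚ.positive 0<ε
    0<ε/2 : 0ℚ ℚ.< ½ ℚ.* ε
    0<ε/2 = ℚ.positive⁻¹ (½ ℚ.* ε) {{ℚ.pos*pos⇒pos ½ ε}}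
    M  = proj₁ (cx (½ ℚ.* ε) 0<ε/2)
    hx = proj₂ (cx (½ ℚ.* ε) 0<ε/2)
    N  = proj₁ (cy (½ ℚ.* ε) 0<ε/2)
    hy = proj₂ (cy (½ ℚ.* ε) 0<ε/2)

  eventually-bounded : ∀ {x} → IsCauchy x →
    ∃ λ B → Positive B × ∃ λ N → ∀ n → N ℕ.≤ n → ∣ x n ∣ ℚ.≤ B
  eventually-bounded {x} cx =
    1ℚ ℚ.+ ∣ x N ∣ , ℚ.pos+nonNeg⇒pos 1ℚ ∣ x N ∣ {{ℚ.∣-∣-nonNeg (x N)}} , N , λ n p → begin
      ∣ x n ∣
        ≡⟨ cong ∣_∣ (diff-+ (x n) (x N)) ⟩
      ∣ (x n ℚ.- x N) ℚ.+ x N ∣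
        ≤⟨ ℚ.∣p+q∣≤∣p∣+∣q∣ (x n ℚ.- x N) (x N) ⟩
      ∣ x n ℚ.- x N ∣ ℚ.+ ∣ x N ∣
        ≤⟨ ℚ.+-monoˡ-≤ ∣ x N ∣ (hx n N p ℕ.≤-refl) ⟩
      1ℚ ℚ.+ ∣ x N ∣ ∎
    where
    open ℚ.≤-Reasoning
    N  = proj₁ (cx 1ℚ (ℚ.positive⁻¹ 1ℚ))
    hx = proj₂ (cx 1ℚ (ℚ.positive⁻¹ 1ℚ))

  ∣*∣-mono : ∀ p q b c → NonNegative b → ∣ p ∣ ℚ.≤ b → ∣ q ∣ ℚ.≤ c →
             ∣ p ℚ.* q ∣ ℚ.≤ b ℚ.* c
  ∣*∣-mono p q b c b≥0 p≤b q≤c = begin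
      ∣ p ℚ.* q ∣     ≡⟨ ℚ.∣p*q∣≡∣p∣*∣q∣ p q ⟩
      ∣ p ∣ ℚ.* ∣ q ∣ ≤⟨ ℚ.*-monoʳ-≤-nonNeg ∣ q ∣ {{ℚ.∣-∣-nonNeg q}} p≤b ⟩
      b ℚ.* ∣ q ∣     ≤⟨ ℚ.*-monoˡ-≤-nonNeg b {{b≥0}} q≤c ⟩
      b ℚ.* c         ∎
    where open ℚ.≤-Reasoning

  divide : ∀ ε d → 0ℚ ℚ.< ε → Positive d → ∃ λ δ → 0ℚ ℚ.< δ × d ℚ.* δ ≡ ε
  divide ε d 0<ε d⁺ = d⁻¹ ℚ.* ε , ℚ.positive⁻¹ (d⁻¹ ℚ.* ε) {{δ⁺}} , (begin
      d ℚ.* (d⁻¹ ℚ.* ε) ≡⟨ ℚ.*-assoc d d⁻¹ ε ⟨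
      d ℚ.* d⁻¹ ℚ.* ε   ≡⟨ cong (ℚ._* ε) (ℚ.*-inverseʳ d {{d≢0}}) ⟩
      1ℚ ℚ.* ε          ≡⟨ ℚ.*-identityˡ ε ⟩
      ε                 ∎)
    where
    open ≡-Reasoning
    d≢0 : ℚ.NonZero d
    d≢0 = ℚ.pos⇒nonZero d {{d⁺}}
    d⁻¹ : ℚ
    d⁻¹ = (1/ d) {{d≢0}}
    δ⁺ : Positive (d⁻¹ ℚ.* ε)
    δ⁺ = ℚ.pos*pos⇒pos d⁻¹ {{ℚ.1/pos⇒pos d {{d⁺}}}} ε {{ℚ.positive 0<ε}}

  *-diff-bound : ∀ a b c d B C δ ε → (B ℚ.+ C) ℚ.* δ ≡ ε → NonNegative B → NonNegative C →
    ∣ a ∣ ℚ.≤ B → ∣ d ∣ ℚ.≤ C → ∣ a ℚ.- c ∣ ℚ.≤ δ → ∣ b ℚ.- d ∣ ℚ.≤ δ →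
    ∣ a ℚ.* b ℚ.- c ℚ.* d ∣ ℚ.≤ ε
  *-diff-bound a b c d B C δ ε [B+C]δ≡ε B≥0 C≥0 a≤B d≤C a-c≤δ b-d≤δ = begin
      ∣ a ℚ.* b ℚ.- c ℚ.* d ∣
        ≡⟨ cong ∣_∣ (*-diff a b c d) ⟩
      ∣ a ℚ.* (b ℚ.- d) ℚ.+ d ℚ.* (a ℚ.- c) ∣
        ≤⟨ ℚ.∣p+q∣≤∣p∣+∣q∣ (a ℚ.* (b ℚ.- d)) (d ℚ.* (a ℚ.- c)) ⟩
      ∣ a ℚ.* (b ℚ.- d) ∣ ℚ.+ ∣ d ℚ.* (a ℚ.- c) ∣
        ≤⟨ ℚ.+-mono-≤ (∣*∣-mono a (b ℚ.- d) B δ B≥0 a≤B b-d≤δ)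
                      (∣*∣-mono d (a ℚ.- c) C δ C≥0 d≤C a-c≤δ) ⟩
      B ℚ.* δ ℚ.+ C ℚ.* δ
        ≡⟨ ℚ.*-distribʳ-+ δ B C ⟨
      (B ℚ.+ C) ℚ.* δ
        ≡⟨ [B+C]δ≡ε ⟩
      ε ∎
    where open ℚ.≤-Reasoning

  *-cauchy : ∀ {x y} → IsCauchy x → IsCauchy y → IsCauchy (λ n → x n ℚ.* y n)
  *-cauchy {x} {y} cx cy ε 0<ε =
    let B , B⁺ , K , bx = eventually-bounded {x} cx
        C , C⁺ , L , by = eventually-bounded {y} cy
        δ , 0<δ , [B+C]δ≡ε = divide ε (B ℚ.+ C) 0<ε (ℚ.pos+pos⇒pos B {{B⁺}} C {{C⁺}})
        M , hx = cx δ 0<δ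
        N , hy = cy δ 0<δ
    in (K ℕ.⊔ L) ℕ.⊔ (M ℕ.⊔ N) , λ m n p q →
      let KL≤m = ℕ.m⊔n≤o⇒m≤o (K ℕ.⊔ L) (M ℕ.⊔ N) p
          KL≤n = ℕ.m⊔n≤o⇒m≤o (K ℕ.⊔ L) (M ℕ.⊔ N) q
          MN≤m = ℕ.m⊔n≤o⇒n≤o (K ℕ.⊔ L) (M ℕ.⊔ N) p
          MN≤n = ℕ.m⊔n≤o⇒n≤o (K ℕ.⊔ L) (M ℕ.⊔ N) q
      in *-diff-bound (x m) (y m) (x n) (y n) B C δ ε [B+C]δ≡ε
           (ℚ.pos⇒nonNeg B {{B⁺}}) (ℚ.pos⇒nonNeg C {{C⁺}})
           (bx m (ℕ.m⊔n≤o⇒m≤o K L KL≤m)) (by n (ℕ.m⊔n≤o⇒n≤o K L KL≤n))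
           (hx m n (ℕ.m⊔n≤o⇒m≤o M N MN≤m) (ℕ.m⊔n≤o⇒m≤o M N MN≤n))
           (hy m n (ℕ.m⊔n≤o⇒n≤o M N MN≤m) (ℕ.m⊔n≤o⇒n≤o M N MN≤n))

infixl 6 _+_
infixl 7 _*_

_+_ : ℝ → ℝ → ℝ
x + y = mkℝ (λ n → seq x n ℚ.+ seq y n) (+-cauchy {seq x} {seq y} (cauchy x) (cauchy y))

_*_ : ℝ → ℝ → ℝ
x * y = mkℝ (λ n → seq x n ℚ.* seq y n) (*-cauchy {seq x} {seq y} (cauchy x) (cauchy y))

-- IsSqrt x s: s is the nonnegative square root of x.
IsSqrt : ℝ → ℝ → Set
IsSqrt x s = 0ℝ ≤ s × s * s ≈ x

+-rawMonoid : RawMonoid 0ℓ 0ℓ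
+-rawMonoid = record { Carrier = ℝ ; _≈_ = _≈_ ; _∙_ = _+_ ; ε = 0ℝ }

open RawMonoidDefs +-rawMonoid public using (sum)

Matrix : ℕ → Set
Matrix n = Fin n → Fin n → ℝ

_·_ : ∀ {n} → Matrix n → Vector ℝ n → Vector ℝ n
(A · x) i = sum λ j → A i j * x j

IsEigenvalue : ∀ {n} → Matrix n → ℝ → Set
IsEigenvalue {n} A μ = ∃ λ (x : Vector ℝ n) →
  ¬ (∀ i → x i ≈ 0ℝ) × (∀ i → (A · x) i ≈ μ * x i)

-- Only real eigenvalues are considered; for the symmetric matrices of
-- interest there are no others.
IsLargestEigenvalue : ∀ {n} → Matrix n → ℝ → Set
IsLargestEigenvalue A μ = IsEigenvalue A μ × (∀ ν → IsEigenvalue A ν → ν ≤ μ)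

record Graph (n : ℕ) : Set₁ where
  field
    _∼_    : Rel (Fin n) 0ℓ
    _∼?_   : Decidable _∼_
    symm   : Symmetric _∼_
    irrefl : Irreflexive _≡_ _∼_

adjacencyMatrix : ∀ {n} → Graph n → Matrix n
adjacencyMatrix G i j = if does (i ∼? j) then 1ℝ else 0ℝ
  where open Graph G

-- G ⊇ H: some subgraph of G, not necessarily induced, is isomorphic to H.
infix 4 _⊇_

_⊇_ : ∀ {n m} → Graph n → Graph m → Set
_⊇_ {n} {m} G H = ∃ λ (f : Fin m → Fin n) →
  Injective _≡_ _≡_ f × (∀ {i j} → Graph._∼_ H i j → Graph._∼_ G (f i) (f j))

IsNext : ∀ {r} → Rel (Fin r) 0ℓ
IsNext {r} i j = suc (toℕ i) ≡ toℕ j ⊎ (suc (toℕ i) ≡ r × toℕ j ≡ 0)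

-- The cycle 0 - 1 - ⋯ - (r-1) - 0.  The conjunct i ≢ j matters only at r = 1,
-- and C r is a cycle in the usual sense precisely when r ≥ 3.
C : ∀ r → Graph r
C r = record
  { _∼_    = λ i j → i ≢ j × (IsNext i j ⊎ IsNext j i)
  ; _∼?_   = λ i j → ¬? (i Fin.≟ j) ×-dec (next? i j ⊎-dec next? j i)
  ; symm   = λ (i≢j , e) → (i≢j ∘ sym) , swap e
  ; irrefl = λ i≡j (i≢j , _) → i≢j i≡j
  }
  where
  next? : Decidable (IsNext {r})
  next? i j = (suc (toℕ i) ℕ.≟ toℕ j) ⊎-dec ((suc (toℕ i) ℕ.≟ r) ×-dec (toℕ j ℕ.≟ 0))

{-# OPTIONS --safe #-}
module Submission where

-- Spectral side. Suppose every vertex u satisfies Σ_{v∼u} d(v) ≤ k d(u) + k(n-1).  For a rational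
-- r = k + t with t > 0 and r t ≥ k(n-1), the positive vector z = A1 + t1 then satisfies Az ≤ rz, so
-- pairing |x| with z shows that every eigenvalue is at most r; the hypothesis on μ provides such an
-- r < μ.
--
-- Combinatorial side. If G has no C_{2l+2}, then G - u has no path on 2l+1 vertices with both ends
-- in A = N(u).  With B the remaining vertices, this forces
-- 2e(A) + e(A,B) ≤ (2l-1)|A| + l|B|, which is the inequality above with l ≤ k in place of k.
-- It is proved by deleting vertices b ∈ B with d_A(b) ≤ l, vertices a ∈ A with
-- 2d_A(a) + d_B(a) ≤ 2l-1, and components on at most 2l vertices.  When only the components
-- remain to be deleted, a path with ends in A on 2l+2 vertices can be slid along until the
-- neighbours of its first vertex all lie on it, and then that vertex has too small a degree; so
-- all such paths have at most 2l vertices, and a longest one closes up, by crossing chords, to a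
-- cycle that spans a component.

open import Algebra.Bundles using (CommutativeRing)
import Algebra.Properties.Semiring.Sum
open import Data.Bool.Base using (true; false; if_then_else_)
open import Data.Empty using (⊥; ⊥-elim)
open import Data.Fin.Base using (Fin; zero; suc; toℕ)
import Data.Fin.Properties as Fin
open import Data.Integer.Base as ℤ using (+_)
import Data.Integer.Properties as ℤ
import Data.Integer.Solver as ℤ-Solver
open import Data.List.Base as List using (List; []; _∷_; _++_; reverse; length; map; lookup)
import Data.List.Membership.DecPropositional as DecMembership
open import Data.List.Membership.Propositional using (_∈_; _∉_)
open import Data.List.Membership.Propositional.Properties using (∈-lookup)
import Data.List.Properties as List
open import Data.List.Relation.Binary.Permutation.Propositional using (_↭_; ↭-refl; ↭-sym; ↭-trans; ↭-reflexive; prep; ↭⇒↭ₛ)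
open import Data.List.Relation.Binary.Permutation.Propositional.Properties using (↭-reverse; shift; ++⁺ʳ; ++-comm; ↭-length; ∈-resp-↭)
import Data.List.Relation.Binary.Permutation.Setoid.Properties as Permₛ
open import Data.List.Relation.Unary.All.Properties using (¬Any⇒All¬)
open import Data.List.Relation.Unary.AllPairs using ([]; _∷_)
open import Data.List.Relation.Unary.Any using (here; there)
open import Data.List.Relation.Unary.Linked using (Linked; []; [-]; _∷_)
open import Data.List.Relation.Unary.Unique.Propositional using (Unique)
open import Data.List.Relation.Unary.Unique.Propositional.Properties using (Unique[x∷xs]⇒x∉xs)
open import Data.Nat.Base as ℕ using (ℕ; zero; suc; z≤n; s≤s)
import Data.Nat.ListAction as ListAction
import Data.Nat.Properties as ℕ
import Data.Nat.Solver as ℕ-Solver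
open import Data.Product.Base as Product using (∃; ∃-syntax; _×_; _,_; proj₁)
open import Data.Rational.Base as ℚ using (ℚ; 0ℚ; ∣_∣; Positive; 1/_; _/_; fromℚᵘ)
import Data.Rational.Properties as ℚ
import Data.Rational.Solver as ℚ-Solver
open import Data.Rational.Unnormalised.Base as ℚᵘ using (mkℚᵘ; *≡*)
import Data.Rational.Unnormalised.Properties as ℚᵘ
open import Data.Sum.Base using (_⊎_; inj₁; inj₂; [_,_]′)
open import Data.Unit.Base using (⊤; tt)
open import Data.Vec.Base as Vec using (Vec; []; _∷_; tabulate)
import Data.Vec.Properties as Vec
open import Function.Base using (_∘_; id; case_of_)
open import Function.Definitions using (Injective)
open import Level using (0ℓ)
open import Relation.Binary.Core using (Rel)
open import Relation.Binary.Definitions using (Decidable; Symmetric)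
open import Relation.Binary.PropositionalEquality using (_≡_; _≢_; refl; sym; trans; cong; cong₂; subst; subst₂; setoid; module ≡-Reasoning)
open import Relation.Nullary using (¬_; Dec; yes; no; does; _×-dec_; _→-dec_)
open import Relation.Nullary.Decidable using (decidable-stable; map′)
open import Relation.Unary using (Pred) renaming (Decidable to Decidable₁)
open import Defs

module ℕΣ = Algebra.Properties.Semiring.Sum ℕ.+-*-semiring
module ℚΣ = Algebra.Properties.Semiring.Sum (CommutativeRing.semiring ℚ.+-*-commutativeRing)
open ℕΣ using () renaming (sum to ∑)

module _ {n : ℕ} where
  open DecMembership (Fin._≟_ {n}) public using (_∈?_)

-- Indicators and sums

𝟙 : ∀ {P : Set} → Dec P → ℕ
𝟙 d = if does d then 1 else 0

𝟙-yes : ∀ {P : Set} (d : Dec P) → P → 𝟙 d ≡ 1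
𝟙-yes (yes _) _ = refl
𝟙-yes (no ¬p) p = ⊥-elim (¬p p)

𝟙-no : ∀ {P : Set} (d : Dec P) → ¬ P → 𝟙 d ≡ 0
𝟙-no (yes p) ¬p = ⊥-elim (¬p p)
𝟙-no (no _)  _  = refl

𝟙≤1 : ∀ {P : Set} (d : Dec P) → 𝟙 d ℕ.≤ 1
𝟙≤1 (yes _) = ℕ.≤-refl
𝟙≤1 (no _)  = z≤n

𝟙-mono : ∀ {P Q : Set} (p : Dec P) (q : Dec Q) → (P → Q) → 𝟙 p ℕ.≤ 𝟙 q
𝟙-mono (yes p) q f = ℕ.≤-reflexive (sym (𝟙-yes q (f p)))
𝟙-mono (no _)  q f = z≤n

∑-mono : ∀ {n} {f g : Fin n → ℕ} → (∀ i → f i ℕ.≤ g i) → ∑ f ℕ.≤ ∑ g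
∑-mono {zero}  f≤g = z≤n
∑-mono {suc n} f≤g = ℕ.+-mono-≤ (f≤g zero) (∑-mono (f≤g ∘ suc))

∑-zero : ∀ {n} {f : Fin n → ℕ} → (∀ i → f i ≡ 0) → ∑ f ≡ 0
∑-zero {n} f≡0 = trans (ℕΣ.sum-cong-≗ f≡0) (ℕΣ.sum-replicate-zero n)

∑-single : ∀ {n} (v : Fin n) (f : Fin n → ℕ) → ∑ (λ i → 𝟙 (i Fin.≟ v) ℕ.* f i) ≡ f v
∑-single zero f = trans
  (cong₂ ℕ._+_ (ℕ.*-identityˡ (f zero)) (∑-zero {f = λ i → 𝟙 (suc i Fin.≟ zero) ℕ.* f (suc i)} (λ i → refl)))
  (ℕ.+-identityʳ (f zero))
∑-single (suc v) f = trans (ℕΣ.sum-cong-≗ step) (∑-single v (f ∘ suc))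
  where
  step : ∀ i → 𝟙 (suc i Fin.≟ suc v) ℕ.* f (suc i) ≡ 𝟙 (i Fin.≟ v) ℕ.* f (suc i)
  step i with i Fin.≟ v
  ... | yes _ = refl
  ... | no  _ = refl

total : ∀ {n} → (Fin n → ℕ) → List (Fin n) → ℕ
total g xs = ListAction.sum (map g xs)

-- Counting each vertex with its multiplicity in `xs` turns the total into a sum over all vertices,
-- and every vertex of the support occurs at least once. Repetitions in `xs` only increase the right
-- side.
∑≤total : ∀ {n} (g : Fin n → ℕ) xs → (∀ v → v ∉ xs → g v ≡ 0) → ∑ g ℕ.≤ total g xs
∑≤total {n} g xs supp = ℕ.≤-trans (∑-mono pointwise) (ℕ.≤-reflexive (exchange xs))
  where
  occ : List (Fin n) → Fin n → ℕ
  occ []       v = 0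
  occ (y ∷ ys) v = 𝟙 (v Fin.≟ y) ℕ.* g v ℕ.+ occ ys v
  exchange : ∀ ys → ∑ (occ ys) ≡ total g ys
  exchange []       = ∑-zero {n} (λ _ → refl)
  exchange (y ∷ ys) = trans (ℕΣ.∑-distrib-+ (λ v → 𝟙 (v Fin.≟ y) ℕ.* g v) (occ ys))
                            (cong₂ ℕ._+_ (∑-single y g) (exchange ys))
  hit : ∀ {v} ys → v ∈ ys → g v ℕ.≤ occ ys v
  hit {v} (y ∷ ys) (here v≡y) = ℕ.≤-trans
    (ℕ.≤-reflexive (sym (trans (cong (ℕ._* g v) (𝟙-yes (v Fin.≟ y) v≡y)) (ℕ.*-identityˡ (g v)))))
    (ℕ.m≤m+n _ _)
  hit (y ∷ ys) (there v∈ys) = ℕ.≤-trans (hit ys v∈ys) (ℕ.m≤n+m _ _)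
  pointwise : ∀ v → g v ℕ.≤ occ xs v
  pointwise v with v ∈? xs
  ... | yes v∈xs = hit xs v∈xs
  ... | no  v∉xs = ℕ.≤-trans (ℕ.≤-reflexive (supp v v∉xs)) z≤n

-- Walks and paths

Unique-resp-↭ : ∀ {n} {xs ys : List (Fin n)} → xs ↭ ys → Unique xs → Unique ys
Unique-resp-↭ {n} p = Permₛ.Unique-resp-↭ (setoid (Fin n)) (↭⇒↭ₛ p)

Unique-tail : ∀ {n} {x : Fin n} {xs} → Unique (x ∷ xs) → Unique xs
Unique-tail (_ ∷ u) = u

infixr 5 _∷ᵘ_
_∷ᵘ_ : ∀ {n} {x : Fin n} {xs} → x ∉ xs → Unique xs → Unique (x ∷ xs)
_∷ᵘ_ {xs = xs} x∉xs u = ¬Any⇒All¬ xs x∉xs ∷ u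

∉-∷ : ∀ {n} {x y : Fin n} {xs} → x ≢ y → x ∉ xs → x ∉ (y ∷ xs)
∉-∷ x≢y x∉xs (here p)  = x≢y p
∉-∷ x≢y x∉xs (there p) = x∉xs p

-- Walk E x xs y: xs lists the vertices of a walk from x to y, both included.
data Walk {n : ℕ} (E : Rel (Fin n) 0ℓ) : Fin n → List (Fin n) → Fin n → Set where
  [_] : ∀ x → Walk E x (x ∷ []) x
  _∷_ : ∀ {x y ys z} → E x y → Walk E y ys z → Walk E x (x ∷ ys) z

module _ {n : ℕ} {E : Rel (Fin n) 0ℓ} where

  join : ∀ {x xs y z zs w} → Walk E x xs y → E y z → Walk E z zs w → Walk E x (xs ++ zs) w
  join [ _ ]   e q = e ∷ q
  join (d ∷ p) e q = d ∷ join p e q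

  reverse-walk : Symmetric E → ∀ {x xs y} → Walk E x xs y → Walk E y (reverse xs) x
  reverse-walk E-sym [ x ] = [ x ]
  reverse-walk E-sym (_∷_ {x} {ys = ys} e p) =
    subst (λ zs → Walk E _ zs x) (sym (List.unfold-reverse x ys))
      (join (reverse-walk E-sym p) (E-sym e) [ x ])

  -- Each edge of the walk is handed to `h` with the pieces before and after it, so that `h` can
  -- reroute the path there.
  linked : ∀ {x xs y} {R : Rel (Fin n) 0ℓ} → Walk E x xs y →
    (∀ {pre u v post} → Walk E x pre u → E u v → Walk E v post y → pre ++ post ≡ xs → R u v) →
    Linked R xs
  linked [ x ]         h = [-]
  linked (e ∷ [ _ ])   h = h [ _ ] e [ _ ] refl ∷ [-]
  linked (e ∷ (d ∷ w)) h = h [ _ ] e (d ∷ w) refl ∷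
    linked (d ∷ w) λ p f q eq → h (e ∷ p) f q (cong (_ ∷_) eq)

  split : ∀ {x xs y v} → Walk E x xs y → v ∈ xs → v ≡ x ⊎
    ∃[ pre ] ∃[ u ] ∃[ post ] Walk E x pre u × E u v × Walk E v post y × pre ++ post ≡ xs
  split [ _ ]   (here refl) = inj₁ refl
  split (d ∷ w) (here refl) = inj₁ refl
  split {x} (d ∷ w) (there i) with split w i
  ... | inj₁ refl = inj₂ (_ , _ , _ , [ _ ] , d , w , refl)
  ... | inj₂ (_ , _ , _ , p , f , q , eq) = inj₂ (_ , _ , _ , d ∷ p , f , q , cong (x ∷_) eq)

  -- The edge from `y` to `x` closes the walk, which may then be cut open just before `v` instead.
  rotate : ∀ {x xs y v} → Walk E x xs y → E y x → v ∈ xs →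
    ∃[ ys ] ∃[ z ] Walk E v ys z × E z v × ys ↭ xs
  rotate w e v∈xs with split w v∈xs
  ... | inj₁ refl = _ , _ , w , e , ↭-refl
  ... | inj₂ (pre , _ , post , p , f , q , refl) = _ , _ , join q e p , f , ++-comm post pre

-- For a nonempty list, twice the sum is the sum over consecutive pairs plus the values at the two
-- ends, and each of these `length xs + 1` terms is at most 1.
sparse-total : ∀ {n} (h : Fin n → ℕ) {xs} → (∀ v → h v ℕ.≤ 1) →
  Linked (λ u v → h u ℕ.+ h v ℕ.≤ 1) xs → 2 ℕ.* total h xs ℕ.≤ suc (length xs)
sparse-total h h≤1 []  = z≤n
sparse-total h h≤1 ([-] {x}) = begin
  2 ℕ.* (h x ℕ.+ 0) ≤⟨ ℕ.*-monoʳ-≤ 2 (ℕ.+-monoˡ-≤ 0 (h≤1 x)) ⟩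
  2                 ∎
  where open ℕ.≤-Reasoning
sparse-total {n} h h≤1 (_∷_ {x} {y} {xs} r rs) = begin
  2 ℕ.* (h x ℕ.+ total h (y ∷ xs)) ≡⟨ lemma (h x) (total h (y ∷ xs)) ⟩
  h x ℕ.+ (h x ℕ.+ 2 ℕ.* total h (y ∷ xs)) ≤⟨ ℕ.+-mono-≤ (h≤1 x) (go r rs) ⟩
  suc (suc (length (y ∷ xs)))      ∎
  where
  open ℕ.≤-Reasoning
  open ℕ-Solver.+-*-Solver
  lemma : ∀ a t → 2 ℕ.* (a ℕ.+ t) ≡ a ℕ.+ (a ℕ.+ 2 ℕ.* t)
  lemma = solve 2 (λ a t → con 2 :* (a :+ t) := a :+ (a :+ con 2 :* t)) refl
  lemma′ : ∀ a b t → a ℕ.+ 2 ℕ.* (b ℕ.+ t) ≡ (a ℕ.+ b) ℕ.+ (b ℕ.+ 2 ℕ.* t)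
  lemma′ = solve 3 (λ a b t → a :+ con 2 :* (b :+ t) := (a :+ b) :+ (b :+ con 2 :* t)) refl
  go : ∀ {x y xs} → h x ℕ.+ h y ℕ.≤ 1 → Linked (λ u v → h u ℕ.+ h v ℕ.≤ 1) (y ∷ xs) →
    h x ℕ.+ 2 ℕ.* total h (y ∷ xs) ℕ.≤ suc (length (y ∷ xs))
  go {x} {y} r [-] = begin
    h x ℕ.+ 2 ℕ.* (h y ℕ.+ 0)           ≡⟨ lemma′ (h x) (h y) 0 ⟩
    (h x ℕ.+ h y) ℕ.+ (h y ℕ.+ 0)       ≤⟨ ℕ.+-mono-≤ r (ℕ.+-monoˡ-≤ 0 (h≤1 y)) ⟩
    2                                   ∎
  go {x} {y} {xs} r (r′ ∷ rs) = begin
    h x ℕ.+ 2 ℕ.* (h y ℕ.+ total h xs)            ≡⟨ lemma′ (h x) (h y) (total h xs) ⟩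
    (h x ℕ.+ h y) ℕ.+ (h y ℕ.+ 2 ℕ.* total h xs)  ≤⟨ ℕ.+-mono-≤ r (go r′ rs) ⟩
    suc (suc (length xs))                         ∎

-- Pairing `f` at each vertex with `g` at its predecessor leaves only `f x` and `g y` unpaired. This
-- is the chord count from the theorems of Dirac and Ore on Hamiltonian cycles, with `f` and `g` the
-- adjacency to the two ends of a path.
crossing-total : ∀ {n} {E : Rel (Fin n) 0ℓ} (f g : Fin n → ℕ) {x xs y} → Walk E x xs y →
  Linked (λ u v → f v ℕ.+ g u ℕ.≤ 1) xs →
  total f xs ℕ.+ total g xs ℕ.+ 1 ℕ.≤ f x ℕ.+ g y ℕ.+ length xs
crossing-total f g {x} [ _ ] _ = ℕ.≤-reflexive (lemma (f x) (g x))
  where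
  open ℕ-Solver.+-*-Solver
  lemma : ∀ a b → a ℕ.+ 0 ℕ.+ (b ℕ.+ 0) ℕ.+ 1 ≡ a ℕ.+ b ℕ.+ 1
  lemma = solve 2 (λ a b → a :+ con 0 :+ (b :+ con 0) :+ con 1 := a :+ b :+ con 1) refl
crossing-total f g {x} {y = y} (_∷_ {y = v} {ys} e w) ls = begin
  f x ℕ.+ total f ys ℕ.+ (g x ℕ.+ total g ys) ℕ.+ 1
    ≡⟨ lemma (f x) (g x) (total f ys) (total g ys) ⟩
  f x ℕ.+ g x ℕ.+ (total f ys ℕ.+ total g ys ℕ.+ 1)
    ≤⟨ ℕ.+-monoʳ-≤ (f x ℕ.+ g x) (crossing-total f g w (tail w ls)) ⟩
  f x ℕ.+ g x ℕ.+ (f v ℕ.+ g y ℕ.+ length ys)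
    ≡⟨ lemma′ (f x) (g x) (f v) (g y) (length ys) ⟩
  f x ℕ.+ g y ℕ.+ ((f v ℕ.+ g x) ℕ.+ length ys)
    ≤⟨ ℕ.+-monoʳ-≤ (f x ℕ.+ g y) (ℕ.+-monoˡ-≤ (length ys) (head w ls)) ⟩
  f x ℕ.+ g y ℕ.+ suc (length ys) ∎
  where
  open ℕ.≤-Reasoning
  open ℕ-Solver.+-*-Solver
  lemma : ∀ a b s t → a ℕ.+ s ℕ.+ (b ℕ.+ t) ℕ.+ 1 ≡ a ℕ.+ b ℕ.+ (s ℕ.+ t ℕ.+ 1)
  lemma = solve 4 (λ a b s t → a :+ s :+ (b :+ t) :+ con 1 := a :+ b :+ (s :+ t :+ con 1)) refl
  lemma′ : ∀ a b c d t → a ℕ.+ b ℕ.+ (c ℕ.+ d ℕ.+ t) ≡ a ℕ.+ d ℕ.+ ((c ℕ.+ b) ℕ.+ t)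
  lemma′ = solve 5 (λ a b c d t → a :+ b :+ (c :+ d :+ t) := a :+ d :+ ((c :+ b) :+ t)) refl
  R = λ u v → f v ℕ.+ g u ℕ.≤ 1
  tail : ∀ {E v ys y} → Walk E v ys y → Linked R (x ∷ ys) → Linked R ys
  tail [ _ ]   (_ ∷ ls) = ls
  tail (_ ∷ _) (_ ∷ ls) = ls
  head : ∀ {E v ys y} → Walk E v ys y → Linked R (x ∷ ys) → R x v
  head [ _ ]   (r ∷ _) = r
  head (_ ∷ _) (r ∷ _) = r

-- Graphs with large degrees and no path on 2k + 1 vertices with both ends in A

NoPath : ∀ {n} → Rel (Fin n) 0ℓ → Pred (Fin n) 0ℓ → ℕ → Set
NoPath E A p = ∀ {x xs y} → Walk E x xs y → Unique xs → A x → A y → length xs ≢ p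

module Dense {n k : ℕ} (1≤k : 1 ℕ.≤ k)
  {E : Rel (Fin n) 0ℓ} (E? : Decidable E) (E-sym : Symmetric E) (E-irr : ∀ {x} → ¬ E x x)
  {A : Pred (Fin n) 0ℓ} (A? : Decidable₁ A) (outer : ∀ {x y} → E x y → ¬ A x → A y)
  where

  e : Fin n → Fin n → ℕ
  e x y = 𝟙 (E? x y)

  deg : Fin n → ℕ
  deg x = ∑ (e x)

  -- Neighbours in `A` count twice, so `wdeg a` is 2d_A(a) + d_B(a), the amount by which deleting
  -- `a` in `A` lowers 2e(A) + e(A,B).
  weight : Fin n → Fin n → ℕ
  weight x y = e x y ℕ.* suc (𝟙 (A? y))

  wdeg : Fin n → ℕ
  wdeg x = ∑ (weight x)

  wdeg≤2deg : ∀ x → wdeg x ℕ.≤ deg x ℕ.+ deg x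
  wdeg≤2deg x = ℕ.≤-trans (∑-mono bound) (ℕ.≤-reflexive (ℕΣ.∑-distrib-+ (e x) (e x)))
    where
    bound : ∀ y → weight x y ℕ.≤ e x y ℕ.+ e x y
    bound y = ℕ.≤-trans (ℕ.*-monoʳ-≤ (e x y) (s≤s (𝟙≤1 (A? y))))
      (ℕ.≤-reflexive (trans (ℕ.*-comm (e x y) 2) (cong (e x y ℕ.+_) (ℕ.+-identityʳ (e x y)))))

  deg≤total : ∀ {x} xs → (∀ {v} → E x v → v ∈ xs) → deg x ℕ.≤ total (e x) xs
  deg≤total {x} xs inside = ∑≤total (e x) xs λ v v∉xs → 𝟙-no (E? x v) (v∉xs ∘ inside)

  disjoint : ∀ {u v x y} → ¬ (E u v × E x y) → e u v ℕ.+ e x y ℕ.≤ 1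
  disjoint {u} {v} {x} {y} ¬both with E? u v | E? x y
  ... | yes p | yes q = ⊥-elim (¬both (p , q))
  ... | yes _ | no  _ = ℕ.≤-refl
  ... | no  _ | yes _ = ℕ.≤-refl
  ... | no  _ | no  _ = z≤n

  -- If `b` were adjacent to two consecutive vertices, inserting it between them would give a path
  -- with one more vertex. So no two neighbours of `b` are consecutive, and at most half of the
  -- path, rounded up, is adjacent to `b`.
  inside-deg≤k : ∀ {x xs y b} → Walk E x xs y → Unique xs → A x → A y → b ∉ xs →
    NoPath E A (suc (length xs)) → length xs ℕ.≤ 2 ℕ.* k → (∀ {v} → E b v → v ∈ xs) → deg b ℕ.≤ k
  inside-deg≤k {x} {xs} {y} {b} w u Ax Ay b∉xs none p≤2k inside =
    ℕ.≤-trans (deg≤total xs inside) (ℕ.*-cancelˡ-≤ 2 (halve (total (e b) xs) k bound))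
    where
    insert : ∀ {pre s t post} → Walk E x pre s → E s t → Walk E t post y → pre ++ post ≡ xs →
      e b s ℕ.+ e b t ℕ.≤ 1
    insert {pre} {post = post} p _ q eq = disjoint λ (bs , bt) →
      none (join p (E-sym bs) (bt ∷ q))
        (Unique-resp-↭ (↭-sym perm) (b∉xs ∷ᵘ u)) Ax Ay (↭-length perm)
      where
      perm : pre ++ b ∷ post ↭ b ∷ xs
      perm = ↭-trans (shift b pre post) (↭-reflexive (cong (b ∷_) eq))
    bound : 2 ℕ.* total (e b) xs ℕ.≤ suc (2 ℕ.* k)
    bound = ℕ.≤-trans (sparse-total (e b) (λ v → 𝟙≤1 (E? b v)) (linked w insert)) (s≤s p≤2k)
    -- Parity absorbs the extra 1 left by `sparse-total`.
    halve : ∀ a b → 2 ℕ.* a ℕ.≤ suc (2 ℕ.* b) → 2 ℕ.* a ℕ.≤ 2 ℕ.* b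
    halve a b h with ℕ.m≤n⇒m<n∨m≡n h
    ... | inj₁ (s≤s h′) = h′
    ... | inj₂ eq = ⊥-elim (ℕ.even≢odd a b eq)

  module _
    (A-dense : ∀ {a} → A a → 2 ℕ.* k ℕ.≤ wdeg a)
    (B-dense : ∀ {b v} → ¬ A b → E b v → k ℕ.< deg b)
    (no[2k+1] : NoPath E A (suc (2 ℕ.* k)))
    where

    -- In a run u, v, w of the path with c adjacent to w, u is not in A.  So w contributes at most
    -- 2, and then v, being a neighbour of u, is in A, so that the vertex after w contributes nothing.
    weight-inside : ∀ c {x xs y} → Walk E x xs y → 4 ℕ.≤ length xs →
      (∀ {pre u v w post} → Walk E x pre u → E u v → E v w → Walk E w post y →
         pre ++ v ∷ post ≡ xs → E c w → ¬ A u) →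
      (∀ {pre p} → Walk E x pre p → E p y → pre ++ y ∷ [] ≡ xs → ¬ A p) →
      total (weight c) (List.drop 2 xs) ℕ.≤ length (List.drop 4 xs) ℕ.+ (1 ℕ.∸ 𝟙 (A? x))
    weight-inside c [ _ ] (s≤s ())
    weight-inside c (_ ∷ [ _ ]) (s≤s (s≤s ()))
    weight-inside c (_ ∷ (_ ∷ [ _ ])) (s≤s (s≤s (s≤s ())))
    -- On four vertices: `p` is outside `A`, hence `s` is in `A` and `y` cannot be adjacent to `c`.
    -- The vertex `p` weighs at most 1, and if it is adjacent to `c`, then `x` is outside `A` and
    -- the extra term of the bound pays for it.
    weight-inside c {x} {_} {y} (_∷_ {y = s} f (_∷_ {y = p} g (h ∷ [ _ ]))) _ triple end
      with E? c y
    ... | yes cy = ⊥-elim (triple (f ∷ [ _ ]) g h [ _ ] refl cy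
                     (outer (E-sym g) (end (f ∷ (g ∷ [ _ ])) h refl)))
    ... | no ¬cy with E? c p
    ...   | no ¬cp = z≤n
    ...   | yes cp rewrite 𝟙-no (A? p) (end (f ∷ (g ∷ [ _ ])) h refl)
                         | 𝟙-no (A? x) (triple [ _ ] f g (h ∷ [ _ ]) refl cp) = ℕ.≤-refl
    weight-inside c {x} {_} {y} (_∷_ {y = s} f (_∷_ {y = t} g r@(h ∷ (i ∷ w)))) _ triple end =
      step w (weight-inside c (g ∷ r) (s≤s (s≤s (s≤s (length≥1 w))))
              (λ p d d′ q eq → triple (f ∷ p) d d′ q (cong (x ∷_) eq))
              (λ p d eq → end (f ∷ p) d (cong (x ∷_) eq)))
      where
      length≥1 : ∀ {v vs z} → Walk E v vs z → 1 ℕ.≤ length vs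
      length≥1 [ _ ]   = s≤s z≤n
      length≥1 (_ ∷ _) = s≤s z≤n
      length-drop : ∀ {v vs z} → Walk E v vs z → length vs ≡ suc (length (List.drop 1 vs))
      length-drop [ _ ]   = refl
      length-drop (_ ∷ _) = refl
      -- The term `1 ∸ 𝟙 (A? x)` acts as a credit of a walk that starts outside `A`. Once it is
      -- spent on a `t` of weight 2, the next start `s` lies in `A` and passes on no credit.
      local : weight c t ℕ.+ (1 ℕ.∸ 𝟙 (A? s)) ℕ.≤ suc (1 ℕ.∸ 𝟙 (A? x))
      local with A? x | E? c t
      ... | yes Ax | yes ct = ⊥-elim (triple [ _ ] f g r refl ct Ax)
      ... | yes Ax | no _   = ℕ.m∸n≤m 1 (𝟙 (A? s))
      ... | no ¬Ax | no _   = ℕ.≤-trans (ℕ.m∸n≤m 1 (𝟙 (A? s))) (s≤s z≤n)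
      ... | no ¬Ax | yes ct rewrite 𝟙-yes (A? s) (outer f ¬Ax)
              = ℕ.≤-trans (ℕ.≤-reflexive (trans (ℕ.+-identityʳ _) (ℕ.+-identityʳ _))) (s≤s (𝟙≤1 (A? t)))
      step : ∀ {T v vs z} → Walk E v vs z → T ℕ.≤ length (List.drop 1 vs) ℕ.+ (1 ℕ.∸ 𝟙 (A? s)) →
        weight c t ℕ.+ T ℕ.≤ length vs ℕ.+ (1 ℕ.∸ 𝟙 (A? x))
      step {T} {vs = vs} w T≤ = begin
        weight c t ℕ.+ T                          ≤⟨ ℕ.+-monoʳ-≤ (weight c t) T≤ ⟩
        weight c t ℕ.+ (l ℕ.+ (1 ℕ.∸ 𝟙 (A? s)))   ≡⟨ lemma (weight c t) l (1 ℕ.∸ 𝟙 (A? s)) ⟩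
        l ℕ.+ (weight c t ℕ.+ (1 ℕ.∸ 𝟙 (A? s)))   ≤⟨ ℕ.+-monoʳ-≤ l local ⟩
        l ℕ.+ suc (1 ℕ.∸ 𝟙 (A? x))                ≡⟨ ℕ.+-suc l _ ⟩
        suc l ℕ.+ (1 ℕ.∸ 𝟙 (A? x))                ≡⟨ cong (ℕ._+ (1 ℕ.∸ 𝟙 (A? x))) (length-drop w) ⟨
        length vs ℕ.+ (1 ℕ.∸ 𝟙 (A? x))            ∎
        where
        open ℕ.≤-Reasoning
        open ℕ-Solver.+-*-Solver
        l = length (List.drop 1 vs)
        lemma : ∀ a b c → a ℕ.+ (b ℕ.+ c) ≡ b ℕ.+ (a ℕ.+ c)
        lemma = solve 3 (λ a b c → a :+ (b :+ c) := b :+ (a :+ c)) refl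

    HeadOutside : List (Fin n) → Set
    HeadOutside []      = ⊤
    HeadOutside (v ∷ _) = ¬ A v

    HeadOutside-++ : ∀ t {b s} → HeadOutside t → ¬ A b → HeadOutside (t ++ b ∷ s)
    HeadOutside-++ []      _   ¬Ab = ¬Ab
    HeadOutside-++ (_ ∷ _) ¬Av _   = ¬Av

    -- Were all neighbours of `x` on the path, `wdeg x` would be at most 2k - 1, against `A-dense`:
    -- the second vertex is outside `A` and contributes at most 1, and `weight-inside` bounds the
    -- rest by 2k - 2.
    no-closed-end : ∀ {x xs y} → Walk E x xs y → Unique xs → A x → A y → length xs ≡ 2 ℕ.+ 2 ℕ.* k →
      (∀ {pre p} → Walk E x pre p → E p y → pre ++ y ∷ [] ≡ xs → ¬ A p) →
      ¬ (∀ {v} → E x v → v ∈ xs)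
    no-closed-end [ _ ] _ _ _ ()
    no-closed-end {x} {xs} {y} w@(_∷_ {y = v} {ys} f q) u Ax Ay len end inside =
      ℕ.<-irrefl refl (begin-strict
        2 ℕ.* k                                    ≤⟨ A-dense Ax ⟩
        wdeg x                                     ≤⟨ ∑≤total (weight x) xs outside ⟩
        weight x x ℕ.+ total (weight x) ys
          ≡⟨ cong (λ a → a ℕ.* suc (𝟙 (A? x)) ℕ.+ total (weight x) ys) (𝟙-no (E? x x) E-irr) ⟩
        total (weight x) ys                        ≡⟨ first q ⟩
        weight x v ℕ.+ total (weight x) (List.drop 1 ys)
                                                   ≤⟨ ℕ.+-mono-≤ v-light rest ⟩
        1 ℕ.+ length (List.drop 3 ys)              <⟨ ℕ.≤-refl ⟩
        2 ℕ.+ length (List.drop 3 ys)              ≡⟨ cong (2 ℕ.+_) (List.length-drop 3 ys) ⟩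
        2 ℕ.+ (length ys ℕ.∸ 3)                    ≡⟨ cong (λ l → 2 ℕ.+ (l ℕ.∸ 3)) (ℕ.suc-injective len) ⟩
        2 ℕ.+ (2 ℕ.* k ℕ.∸ 2)                      ≡⟨ ℕ.m+[n∸m]≡n 2≤2k ⟩
        2 ℕ.* k                                    ∎)
      where
      open ℕ.≤-Reasoning
      2≤2k : 2 ℕ.≤ 2 ℕ.* k
      2≤2k = ℕ.*-monoʳ-≤ 2 1≤k
      outside : ∀ v → v ∉ xs → weight x v ≡ 0
      outside v v∉xs rewrite 𝟙-no (E? x v) (v∉xs ∘ inside) = refl
      first : ∀ {v ys} → Walk E v ys y →
        total (weight x) ys ≡ weight x v ℕ.+ total (weight x) (List.drop 1 ys)
      first [ _ ]   = refl
      first (_ ∷ _) = refl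
      ¬Av : ¬ A v
      ¬Av Av = no[2k+1] q (Unique-tail u) Av Ay (ℕ.suc-injective len)
      v-light : weight x v ℕ.≤ 1
      v-light rewrite 𝟙-no (A? v) ¬Av | ℕ.*-identityʳ (e x v) = 𝟙≤1 (E? x v)
      -- If `s` were in `A`, going back from `s` to `x`, along the chord to `r` and on to `y` would
      -- miss only `t`, a path on 2k + 1 vertices.
      triple : ∀ {pre s t r post} → Walk E x pre s → E s t → E t r → Walk E r post y →
         pre ++ t ∷ post ≡ xs → E x r → ¬ A s
      triple {pre} {s} {t} {r} {post} p _ _ q eq xr As =
        no[2k+1] (join (reverse-walk E-sym p) xr q)
          (Unique-tail (Unique-resp-↭ (↭-sym perm) u)) As Ay
          (ℕ.suc-injective (trans (↭-length perm) len))
        where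
        perm : t ∷ reverse pre ++ post ↭ xs
        perm = ↭-trans (prep t (++⁺ʳ post (↭-reverse pre)))
                 (↭-trans (↭-sym (shift t pre post)) (↭-reflexive eq))
      rest : total (weight x) (List.drop 1 ys) ℕ.≤ length (List.drop 3 ys)
      rest = ℕ.≤-trans
        (weight-inside x w (ℕ.≤-trans (s≤s (s≤s 2≤2k)) (ℕ.≤-reflexive (sym len))) triple end)
        (ℕ.≤-reflexive (trans (cong (λ a → length (List.drop 3 ys) ℕ.+ (1 ℕ.∸ a)) (𝟙-yes (A? x) Ax))
                              (ℕ.+-identityʳ _)))

    -- By `no-closed-end`, `x` has a neighbour `v` off the path. Appending `v` to `ws` makes 2k + 1
    -- vertices, so `v` is outside `A`; its degree exceeds k, so by `inside-deg≤k` it has a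
    -- neighbour `a` not in `ws`. Dropping `y` and `s` and appending `v` and `a` gives the path
    -- passed to `next`.
    slide-step : ∀ {x y s ws} → Walk E y (y ∷ s ∷ ws) x → Unique (y ∷ s ∷ ws) → A x → A y →
      length ws ≡ 2 ℕ.* k →
      (∀ {z a b} → Walk E z (ws ++ b ∷ a ∷ []) a → Unique (ws ++ b ∷ a ∷ []) → A z → A a → ¬ A b → ⊥) → ⊥
    slide-step (_ ∷ [ _ ]) _ _ _ len _ with () ← ℕ.≤-trans (ℕ.*-monoʳ-≤ 2 1≤k) (ℕ.≤-reflexive (sym len))
    slide-step {x} {y} {s} {ws} R@(g ∷ R′@(_∷_ {y = z} h W)) u Ax Ay len next =
      no-closed-end (reverse-walk E-sym R) (Unique-resp-↭ (↭-sym (↭-reverse (y ∷ s ∷ ws))) u) Ax Ay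
        (trans (List.length-reverse (y ∷ s ∷ ws)) (cong (2 ℕ.+_) len)) end
        (∈-resp-↭ (↭-sym (↭-reverse (y ∷ s ∷ ws))) ∘ inside)
      where
      uW = Unique-tail (Unique-tail u)
      ¬As : ¬ A s
      ¬As As = no[2k+1] R′ (Unique-tail u) As Ax (cong suc len)
      Az = outer h ¬As
      end : ∀ {pre p} → Walk E x pre p → E p y → pre ++ y ∷ [] ≡ reverse (y ∷ s ∷ ws) → ¬ A p
      end {pre} p py eq Ap = no[2k+1] p
        (Unique-tail (Unique-resp-↭ (↭-sym perm) u)) Ax Ap
        (ℕ.suc-injective (trans (↭-length perm) (cong (2 ℕ.+_) len)))
        where
        perm : y ∷ pre ↭ y ∷ s ∷ ws
        perm = ↭-trans (++-comm (y ∷ []) pre) (↭-trans (↭-reflexive eq) (↭-reverse (y ∷ s ∷ ws)))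
      inside : ∀ {v} → E x v → v ∈ y ∷ s ∷ ws
      inside {v} xv with v ∈? (y ∷ s ∷ ws) | A? v
      ... | yes v∈ | _ = v∈
      ... | no v∉ | yes Av = ⊥-elim (no[2k+1] (join W xv [ v ])
              (Unique-resp-↭ (++-comm (v ∷ []) ws) ((v∉ ∘ there ∘ there) ∷ᵘ uW)) Az Av
              (trans (↭-length (++-comm ws (v ∷ []))) (cong suc len)))
      ... | no v∉ | no ¬Av = ⊥-elim (ℕ.<⇒≱ (B-dense ¬Av (E-sym xv))
              (inside-deg≤k W uW Az Ax v∉ws
                (subst (NoPath E A ∘ suc) (sym len) no[2k+1]) (ℕ.≤-reflexive len) nbrs))
        where
        v∉ws : v ∉ ws
        v∉ws = v∉ ∘ there ∘ there
        nbrs : ∀ {a} → E v a → a ∈ ws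
        nbrs {a} va with a ∈? ws
        ... | yes a∈ = a∈
        ... | no a∉ = ⊥-elim (next (join W xv (va ∷ [ a ]))
                (Unique-resp-↭ (++-comm (v ∷ a ∷ []) ws) (∉-∷ (λ { refl → E-irr va }) v∉ws ∷ᵘ a∉ ∷ᵘ uW))
                Az (outer va ¬Av) ¬Av)

    -- f is the part of the initial path not yet dropped and t the part added by sliding; t starts
    -- outside A, so it can never make up a whole path with ends in A.
    slide : ∀ j f t {x y} → length f ≡ j ℕ.+ j → HeadOutside t → Walk E y (f ++ t) x →
      Unique (f ++ t) → A x → A y → length (f ++ t) ≢ 2 ℕ.+ 2 ℕ.* k
    slide zero [] _ _ ¬Ay [ _ ]   _ _ Ay _ = ¬Ay Ay
    slide zero [] _ _ ¬Ay (_ ∷ _) _ _ Ay _ = ¬Ay Ay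
    slide (suc j) (_ ∷ []) t eq _ _ _ _ _ _ = ℕ.1+n≢0 (sym (trans (ℕ.suc-injective eq) (ℕ.+-suc j j)))
    slide (suc j) (y ∷ s ∷ f) t eq ¬At w@(_ ∷ _) u Ax Ay len = slide-step w u Ax Ay |ws|
      λ {_} {a} {b} w′ u′ Az Aa ¬Ab →
        let assoc = List.++-assoc f t (b ∷ a ∷ []) in
        slide j f (t ++ b ∷ a ∷ []) (ℕ.suc-injective (ℕ.suc-injective (trans eq (cong suc (ℕ.+-suc j j)))))
          (HeadOutside-++ t ¬At ¬Ab)
          (subst (λ l → Walk E _ l a) assoc w′) (subst Unique assoc u′) Aa Az
          (trans (cong length (sym assoc))
            (trans (↭-length (++-comm (f ++ t) (b ∷ a ∷ []))) (cong (2 ℕ.+_) |ws|)))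
      where
      |ws| : length (f ++ t) ≡ 2 ℕ.* k
      |ws| = ℕ.suc-injective (ℕ.suc-injective len)

    no[2k+2] : NoPath E A (2 ℕ.+ 2 ℕ.* k)
    no[2k+2] {x} {xs} {y} w u Ax Ay len =
      slide (suc k) xs [] (trans len lemma) tt (subst (λ l → Walk E x l y) eq w) (subst Unique eq u) Ay Ax
        (trans (cong length (sym eq)) len)
      where
      open ℕ-Solver.+-*-Solver
      eq = sym (List.++-identityʳ xs)
      lemma : 2 ℕ.+ 2 ℕ.* k ≡ suc k ℕ.+ suc k
      lemma = solve 1 (λ k → con 2 :+ con 2 :* k := (con 1 :+ k) :+ (con 1 :+ k)) refl k

    -- Removing the first vertex, or the first two if the second is outside `A`, leaves a path with
    -- both ends in `A`. So two consecutive excluded lengths exclude every larger one.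
    no-long : ∀ {p} → 2 ℕ.* k ℕ.< p → NoPath E A p
    no-long {p} 2k<p = subst (NoPath E A) (ℕ.m+[n∸m]≡n 2k<p)
      (λ {x} {xs} {y} → proj₁ (consecutive (p ℕ.∸ suc (2 ℕ.* k))) {x} {xs} {y})
      where
      shrink : ∀ {q} → NoPath E A q → NoPath E A (suc q) → NoPath E A (2 ℕ.+ q)
      shrink none none′ [ _ ] _ _ _ ()
      shrink none none′ (_∷_ {y = v} e w) u Ax Ay len with A? v
      ... | yes Av = none′ w (Unique-tail u) Av Ay (ℕ.suc-injective len)
      shrink none none′ (e ∷ [ _ ]) u Ax Ay len | no ¬Av = ¬Av Ay
      shrink none none′ (e ∷ (d ∷ w)) u Ax Ay len | no ¬Av =
        none w (Unique-tail (Unique-tail u)) (outer d ¬Av) Ay (ℕ.suc-injective (ℕ.suc-injective len))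
      consecutive : ∀ d → NoPath E A (suc (2 ℕ.* k) ℕ.+ d) × NoPath E A (suc (suc (2 ℕ.* k) ℕ.+ d))
      consecutive zero = subst (λ q → NoPath E A q × NoPath E A (suc q)) (sym (ℕ.+-identityʳ _))
        (no[2k+1] , no[2k+2])
      consecutive (suc d) with none , none′ ← consecutive d =
        subst (λ q → NoPath E A q × NoPath E A (suc q)) (sym (ℕ.+-suc (suc (2 ℕ.* k)) d))
          (none′ , shrink none none′)

    -- Longest paths with both ends in `A`

    module Longest {p} (p≤2k : p ℕ.≤ 2 ℕ.* k) (longest : ∀ {q} → p ℕ.< q → NoPath E A q) where

      -- A neighbour of `x` in `A` off the path would extend it by one vertex. One outside `A` has
      -- more than k neighbours, so by `inside-deg≤k` one of them is off the path too, and the path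
      -- extends by two.
      end-inside : ∀ {x xs y} → Walk E x xs y → Unique xs → A x → A y → length xs ≡ p →
        ∀ {v} → E x v → v ∈ xs
      end-inside {x} {xs} w u Ax Ay refl {v} xv with v ∈? xs | A? v
      ... | yes v∈ | _ = v∈
      ... | no v∉ | yes Av = ⊥-elim (longest ℕ.≤-refl (E-sym xv ∷ w) (v∉ ∷ᵘ u) Av Ay refl)
      ... | no v∉ | no ¬Av = ⊥-elim (ℕ.<⇒≱ (B-dense ¬Av (E-sym xv))
              (inside-deg≤k w u Ax Ay v∉ (longest ℕ.≤-refl) p≤2k nbrs))
        where
        nbrs : ∀ {a} → E v a → a ∈ xs
        nbrs {a} va with a ∈? xs
        ... | yes a∈ = a∈
        ... | no a∉ = ⊥-elim (longest (ℕ.n≤1+n _) (E-sym va ∷ (E-sym xv ∷ w))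
                (∉-∷ (λ { refl → E-irr va }) a∉ ∷ᵘ v∉ ∷ᵘ u) (outer va ¬Av) Ay refl)

      drop-last : ∀ {v xs z} → Walk E v xs z → E z v →
        ∃[ z′ ] ∃[ ds ] Walk E z′ ds v × E z z′ × z ∷ ds ↭ xs
      drop-last {v} {xs} w zv = go (reverse-walk E-sym w) zv (↭-reverse xs)
        where
        go : ∀ {rs z} → Walk E z rs v → E z v → rs ↭ xs →
          ∃[ z′ ] ∃[ ds ] Walk E z′ ds v × E z z′ × z ∷ ds ↭ xs
        go [ _ ]   zz _    = ⊥-elim (E-irr zz)
        go (e ∷ w) _  perm = _ , _ , w , e , perm

      -- An edge from `v` to `o` off the cycle is exploited by cutting the cycle open next to `v`:
      -- `D` visits all its vertices from `v` to `z`, and `W` all but `z`, ending in `v`. Attaching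
      -- `o`, and a further neighbour of `o` if `o` is outside `A`, gives a path with ends in `A`
      -- that is longer than p, or one on p vertices whose end `z′` has the neighbour `z` off it.
      cycle-closed : ∀ {x xs y} → Walk E x xs y → Unique xs → A x → A y → length xs ≡ p →
        ∀ {r cs t} → Walk E r cs t → E t r → cs ↭ xs → ∀ {v o} → v ∈ xs → E v o → o ∈ xs
      cycle-closed {x} {xs} {y} P u Ax Ay len C tr cs↭xs {v} {o} v∈xs vo with o ∈? xs
      ... | yes o∈ = o∈
      ... | no o∉
        with ds , z , D , zv , ds↭cs ← rotate C tr (∈-resp-↭ (↭-sym cs↭xs) v∈xs)
        with z′ , es , W , zz′ , zes↭ds ← drop-last D zv
        = ⊥-elim (absurd (A? o) (A? z))
        where
        ds↭xs = ↭-trans ds↭cs cs↭xs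
        zes↭xs = ↭-trans zes↭ds ds↭xs
        uD = Unique-resp-↭ (↭-sym ds↭xs) u
        uzes = Unique-resp-↭ (↭-sym zes↭xs) u
        |ds| : length ds ≡ p
        |ds| = trans (↭-length ds↭xs) len
        |es| : suc (length es) ≡ p
        |es| = trans (↭-length zes↭xs) len
        o∉ds : o ∉ ds
        o∉ds = o∉ ∘ ∈-resp-↭ ds↭xs
        o∉zes : o ∉ z ∷ es
        o∉zes = o∉ ∘ ∈-resp-↭ zes↭xs
        absurd : Dec (A o) → Dec (A z) → ⊥
        absurd (yes Ao) (yes Az) =
          longest ℕ.≤-refl (E-sym vo ∷ D) (o∉ds ∷ᵘ uD) Ao Az (cong suc |ds|)
        absurd (yes Ao) (no ¬Az) =
          z∉ (end-inside (join W vo [ o ]) (Unique-resp-↭ perm ((o∉zes ∘ there) ∷ᵘ Unique-tail uzes))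
            (outer zz′ ¬Az) Ao (trans (sym (↭-length perm)) |es|) (E-sym zz′))
          where
          perm : o ∷ es ↭ es ++ o ∷ []
          perm = ++-comm (o ∷ []) es
          z∉ : z ∉ es ++ o ∷ []
          z∉ = ∉-∷ (λ z≡o → o∉zes (here (sym z≡o))) (Unique[x∷xs]⇒x∉xs uzes) ∘ ∈-resp-↭ (↭-sym perm)
        absurd (no ¬Ao) Az? = ℕ.<⇒≱ (B-dense ¬Ao (E-sym vo))
          (inside-deg≤k P u Ax Ay o∉ (subst (NoPath E A ∘ suc) (sym len) (longest ℕ.≤-refl))
            (ℕ.≤-trans (ℕ.≤-reflexive len) p≤2k) λ oa → decidable-stable (_ ∈? xs) (extend Az? oa))
          where
          extend : Dec (A z) → ∀ {a} → E o a → ¬ a ∉ xs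
          extend (yes Az) oa a∉ = longest (ℕ.n≤1+n _) (E-sym oa ∷ (E-sym vo ∷ D))
            (∉-∷ (λ { refl → E-irr oa }) (a∉ ∘ ∈-resp-↭ ds↭xs) ∷ᵘ o∉ds ∷ᵘ uD)
            (outer oa ¬Ao) Az (cong (2 ℕ.+_) |ds|)
          extend (no ¬Az) {a} oa a∉ = longest ℕ.≤-refl (join W vo (oa ∷ [ a ]))
            (Unique-resp-↭ (++-comm (o ∷ a ∷ []) es)
              (∉-∷ (λ { refl → E-irr oa }) (o∉zes ∘ there) ∷ᵘ
               (a∉ ∘ ∈-resp-↭ zes↭xs ∘ there) ∷ᵘ Unique-tail uzes))
            (outer zz′ ¬Az) (outer oa ¬Ao)
            (trans (↭-length (++-comm es (o ∷ a ∷ []))) (cong suc |es|))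


      -- By `end-inside` both ends have all their neighbours on the path. If `x` is adjacent to `t`
      -- and `y` to its predecessor `s`, these chords close the path into a cycle on the same
      -- vertices, which no edge leaves by `cycle-closed`. So `deg x + deg y` is less than p, while
      -- each degree is at least k because `wdeg` is at least 2k.
      none : (∀ {xs a} → length xs ℕ.≤ 2 ℕ.* k → A a → a ∈ xs →
                ¬ (∀ {v o} → v ∈ xs → E v o → o ∈ xs)) → NoPath E A p
      none no-closed {x} {xs} {y} P u Ax Ay len = ℕ.<-irrefl refl (begin-strict
        2 ℕ.* k ℕ.+ 2 ℕ.* k
          ≤⟨ ℕ.+-mono-≤ (A-dense Ax) (A-dense Ay) ⟩
        wdeg x ℕ.+ wdeg y
          ≤⟨ ℕ.+-mono-≤ (wdeg≤2deg x) (wdeg≤2deg y) ⟩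
        (deg x ℕ.+ deg x) ℕ.+ (deg y ℕ.+ deg y)
          ≡⟨ lemma (deg x) (deg y) ⟩
        (deg x ℕ.+ deg y) ℕ.+ (deg x ℕ.+ deg y)
          <⟨ ℕ.+-mono-<-≤ deg-sum (ℕ.<⇒≤ deg-sum) ⟩
        2 ℕ.* k ℕ.+ 2 ℕ.* k ∎)
        where
        open ℕ.≤-Reasoning
        open ℕ-Solver.+-*-Solver
        lemma : ∀ a b → (a ℕ.+ a) ℕ.+ (b ℕ.+ b) ≡ (a ℕ.+ b) ℕ.+ (a ℕ.+ b)
        lemma = solve 2 (λ a b → (a :+ a) :+ (b :+ b) := (a :+ b) :+ (a :+ b)) refl
        R : Walk E y (reverse xs) x
        R = reverse-walk E-sym P
        y-inside : ∀ {v} → E y v → v ∈ xs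
        y-inside = ∈-resp-↭ (↭-reverse xs) ∘ end-inside R (Unique-resp-↭ (↭-sym (↭-reverse xs)) u) Ay Ax
          (trans (List.length-reverse xs) len)
        start∈ : ∀ {x xs y} → Walk E x xs y → x ∈ xs
        start∈ [ _ ]   = here refl
        start∈ (_ ∷ _) = here refl
        cross : ∀ {pre s t post} → Walk E x pre s → E s t → Walk E t post y → pre ++ post ≡ xs →
          e x t ℕ.+ e y s ℕ.≤ 1
        cross {pre} {post = post} w _ q eq = disjoint λ (xt , ys) →
          no-closed (ℕ.≤-trans (ℕ.≤-reflexive len) p≤2k) Ax (start∈ P)
            (cycle-closed P u Ax Ay len (join (reverse-walk E-sym w) xt q) ys
              (↭-trans (++⁺ʳ post (↭-reverse pre)) (↭-reflexive eq)))
        deg-sum : deg x ℕ.+ deg y ℕ.< 2 ℕ.* k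
        deg-sum = begin-strict
          deg x ℕ.+ deg y
            ≤⟨ ℕ.+-mono-≤ (deg≤total xs (end-inside P u Ax Ay len)) (deg≤total xs y-inside) ⟩
          total (e x) xs ℕ.+ total (e y) xs
            <⟨ ℕ.≤-reflexive (ℕ.+-comm 1 _) ⟩
          total (e x) xs ℕ.+ total (e y) xs ℕ.+ 1
            ≤⟨ crossing-total (e x) (e y) P (linked P cross) ⟩
          e x x ℕ.+ e y y ℕ.+ length xs
            ≡⟨ cong₂ (λ a b → a ℕ.+ b ℕ.+ length xs) (𝟙-no (E? x x) E-irr) (𝟙-no (E? y y) E-irr) ⟩
          length xs
            ≤⟨ ℕ.≤-trans (ℕ.≤-reflexive len) p≤2k ⟩
          2 ℕ.* k ∎

    -- A vertex of `A` is itself a path with both ends in `A`. Starting from `no-long`, `descend`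
    -- excludes the lengths 2k, 2k - 1, ..., 1 in turn, each being the longest not yet excluded.
    A-empty : (∀ {xs a} → length xs ℕ.≤ 2 ℕ.* k → A a → a ∈ xs →
                 ¬ (∀ {v o} → v ∈ xs → E v o → o ∈ xs)) → ∀ {a} → ¬ A a
    A-empty no-closed {a} Aa = descend (2 ℕ.* k) ℕ.≤-refl no-long [ a ] ((λ ()) ∷ᵘ []) Aa Aa refl
      where
      descend : ∀ p → p ℕ.≤ 2 ℕ.* k → (∀ {q} → p ℕ.< q → NoPath E A q) → NoPath E A 1
      descend zero    _    longest = longest (s≤s z≤n)
      descend (suc p) p≤2k longest = descend p (ℕ.<⇒≤ p≤2k) λ {q} p<q →
        [ (λ p+1<q → longest p+1<q)
        , (λ { refl → Longest.none p≤2k longest no-closed })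
        ]′ (ℕ.m≤n⇒m<n∨m≡n p<q)

-- The edge bound

-- Inner vertices form `A` and outer ones `B`. Deletion only relabels, so the vertex set stays
-- `Fin n` throughout.
data Label : Set where
  inner outer deleted : Label

inner? : Decidable₁ (_≡ inner)
inner? inner   = yes refl
inner? outer   = no λ ()
inner? deleted = no λ ()

outer? : Decidable₁ (_≡ outer)
outer? inner   = no λ ()
outer? outer   = yes refl
outer? deleted = no λ ()

-- Edges between two outer vertices play no role and are left out.
Joined : Rel Label 0ℓ
Joined inner inner = ⊤
Joined inner outer = ⊤
Joined outer inner = ⊤
Joined _     _     = ⊥

joined? : Decidable Joined
joined? inner   inner   = yes tt
joined? inner   outer   = yes tt
joined? inner   deleted = no λ ()
joined? outer   inner   = yes tt
joined? outer   outer   = no λ ()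
joined? outer   deleted = no λ ()
joined? deleted _       = no λ ()

joined-sym : ∀ a b → Joined a b → Joined b a
joined-sym inner inner _ = tt
joined-sym inner outer _ = tt
joined-sym outer inner _ = tt

joined-outer : ∀ a b → Joined a b → a ≢ inner → b ≡ inner
joined-outer inner _     _ a≢ = ⊥-elim (a≢ refl)
joined-outer outer inner _ _  = refl

joined⇒outer : ∀ a b → Joined a b → a ≢ inner → a ≡ outer
joined⇒outer inner _     _ a≢ = ⊥-elim (a≢ refl)
joined⇒outer outer inner _ _  = refl

joined≢deleted : ∀ a b → Joined a b → b ≢ deleted
joined≢deleted inner inner _ ()
joined≢deleted inner outer _ ()
joined≢deleted outer inner _ ()

∑-const : ∀ n {c} → ∑ {n} (λ _ → c) ≡ n ℕ.* c
∑-const zero    = refl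
∑-const (suc n) = cong (_ ℕ.+_) (∑-const n)

module _ {n : ℕ} (G : Graph n) where
  open Graph G

  g : Fin n → Fin n → ℕ
  g i j = 𝟙 (i ∼? j)

  degree : Fin n → ℕ
  degree i = ∑ (g i)

  module Neighbourhood (u : Fin n) (l : ℕ) (1≤l : 1 ℕ.≤ l)
    (no-cycle : ∀ {x xs y} → Walk _∼_ x xs y → Unique (u ∷ xs) → u ∼ x → u ∼ y → length xs ≢ suc (2 ℕ.* l))
    where

    -- The allowance of an inner vertex in `budget`; that of an outer one is `l`.
    c : ℕ
    c = 2 ℕ.* l ℕ.∸ 1

    1+c≡2l : suc c ≡ 2 ℕ.* l
    1+c≡2l = ℕ.m+[n∸m]≡n (ℕ.≤-trans 1≤l (ℕ.m≤m+n l _))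

    module _ (lab : Fin n → Label) where
      E : Rel (Fin n) 0ℓ
      E x y = x ∼ y × Joined (lab x) (lab y)

      E? : Decidable E
      E? x y = (x ∼? y) ×-dec joined? (lab x) (lab y)

      E-sym : Symmetric E
      E-sym {x} {y} (xy , j) = symm xy , joined-sym (lab x) (lab y) j

      e-sym : ∀ x y → 𝟙 (E? x y) ≡ 𝟙 (E? y x)
      e-sym x y = ℕ.≤-antisym (𝟙-mono (E? x y) (E? y x) E-sym)
                              (𝟙-mono (E? y x) (E? x y) E-sym)

      E-irrefl : ∀ {x} → ¬ E x x
      E-irrefl (xx , _) = irrefl refl xx

      E-outer : ∀ {x y} → E x y → lab x ≢ inner → lab y ≡ inner
      E-outer {x} {y} (_ , j) = joined-outer (lab x) (lab y) j

      α β : Fin n → ℕ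
      α i = 𝟙 (inner? (lab i))
      β i = 𝟙 (outer? (lab i))

      t : Fin n → Fin n → ℕ
      t i j = α i ℕ.* 𝟙 (E? i j)

      -- 2e(A) + e(A,B), as the sum of the degrees of the inner vertices.
      edges : ℕ
      edges = ∑ λ i → ∑ λ j → t i j

      size : ℕ
      size = ∑ α ℕ.+ ∑ β

      budget : ℕ
      budget = c ℕ.* ∑ α ℕ.+ l ℕ.* ∑ β

      module D = Dense 1≤l E? E-sym E-irrefl (inner? ∘ lab) E-outer

    -- Deletions and what they cost

    module Delete (lab : Fin n → Label) {S : Pred (Fin n) 0ℓ} (S? : Decidable₁ S) where

      lab′ : Fin n → Label
      lab′ i = if does (S? i) then deleted else lab i

      Σα Σβ : ℕ
      Σα = ∑ λ i → 𝟙 (S? i) ℕ.* α lab i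
      Σβ = ∑ λ i → 𝟙 (S? i) ℕ.* β lab i

      ∑-split : (h : Label → ℕ) → h deleted ≡ 0 →
        ∑ (h ∘ lab) ≡ ∑ (h ∘ lab′) ℕ.+ ∑ (λ i → 𝟙 (S? i) ℕ.* h (lab i))
      ∑-split h h≡0 = trans (ℕΣ.sum-cong-≗ part) (ℕΣ.∑-distrib-+ (h ∘ lab′) _)
        where
        part : ∀ i → h (lab i) ≡ h (lab′ i) ℕ.+ 𝟙 (S? i) ℕ.* h (lab i)
        part i with S? i
        ... | yes _ = sym (cong₂ ℕ._+_ h≡0 (ℕ.+-identityʳ _))
        ... | no _  = sym (ℕ.+-identityʳ _)

      ∑-α : ∑ (α lab) ≡ ∑ (α lab′) ℕ.+ Σα
      ∑-α = ∑-split (λ a → 𝟙 (inner? a)) refl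

      ∑-β : ∑ (β lab) ≡ ∑ (β lab′) ℕ.+ Σβ
      ∑-β = ∑-split (λ a → 𝟙 (outer? a)) refl

      size-split : size lab ≡ size lab′ ℕ.+ (Σα ℕ.+ Σβ)
      size-split = trans (cong₂ ℕ._+_ ∑-α ∑-β)
        (solve 4 (λ a b x y → (a :+ x) :+ (b :+ y) := (a :+ b) :+ (x :+ y)) refl
          (∑ (α lab′)) (∑ (β lab′)) Σα Σβ)
        where open ℕ-Solver.+-*-Solver

      budget-split : budget lab ≡ budget lab′ ℕ.+ (c ℕ.* Σα ℕ.+ l ℕ.* Σβ)
      budget-split = trans (cong₂ (λ a b → c ℕ.* a ℕ.+ l ℕ.* b) ∑-α ∑-β)
        (solve 6 (λ a b x y c l → c :* (a :+ x) :+ l :* (b :+ y) := (c :* a :+ l :* b) :+ (c :* x :+ l :* y))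
           refl (∑ (α lab′)) (∑ (β lab′)) Σα Σβ c l)
        where open ℕ-Solver.+-*-Solver

      -- The condition on `j` is conditional on an edge so that it also fits `delete-component`,
      -- where it holds because no edge leaves the component.
      t-kept : ∀ i j → ¬ S i → (E lab i j → ¬ S j) → t lab i j ℕ.≤ t lab′ i j
      t-kept i j ¬Si ¬Sj with E? lab i j
      ... | no ¬ij = ℕ.≤-trans (ℕ.≤-reflexive
        (trans (cong (α lab i ℕ.*_) (𝟙-no (E? lab i j) ¬ij)) (ℕ.*-zeroʳ (α lab i)))) z≤n
      ... | yes (ij , joined) = ℕ.≤-reflexive (cong₂ ℕ._*_
              (cong (λ a → 𝟙 (inner? a)) (sym i-kept))
              (trans (𝟙-yes (E? lab i j) (ij , joined))
                (sym (𝟙-yes (E? lab′ i j) (ij , subst id (cong₂ Joined (sym i-kept) (sym j-kept)) joined)))))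
        where
        kept : ∀ k → ¬ S k → lab′ k ≡ lab k
        kept k ¬Sk with S? k
        ... | yes Sk = ⊥-elim (¬Sk Sk)
        ... | no _   = refl
        i-kept = kept i ¬Si
        j-kept = kept j (¬Sj (ij , joined))

    delete-vertex : ∀ lab v → let lab′ = Delete.lab′ lab (Fin._≟ v) in
      edges lab ℕ.≤ edges lab′ ℕ.+ (∑ (t lab v) ℕ.+ ∑ (λ i → t lab i v))
    delete-vertex lab v = begin
      ∑ (λ i → ∑ (t lab i))
        ≤⟨ ∑-mono (λ i → ∑-mono (bound i)) ⟩
      ∑ (λ i → ∑ λ j → t lab′ i j ℕ.+ (𝟙 (i Fin.≟ v) ℕ.* t lab i j ℕ.+ 𝟙 (j Fin.≟ v) ℕ.* t lab i j))
        ≡⟨ ℕΣ.sum-cong-≗ (λ i → trans (ℕΣ.∑-distrib-+ (t lab′ i) _)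
             (cong (∑ (t lab′ i) ℕ.+_) (ℕΣ.∑-distrib-+ (λ j → 𝟙 (i Fin.≟ v) ℕ.* t lab i j) _))) ⟩
      ∑ (λ i → ∑ (t lab′ i) ℕ.+ (row i ℕ.+ col i))
        ≡⟨ trans (ℕΣ.∑-distrib-+ (λ i → ∑ (t lab′ i)) _) (cong (edges lab′ ℕ.+_) (ℕΣ.∑-distrib-+ row col)) ⟩
      edges lab′ ℕ.+ (∑ row ℕ.+ ∑ col)
        ≡⟨ cong (edges lab′ ℕ.+_) (cong₂ ℕ._+_ rows (ℕΣ.sum-cong-≗ λ i → ∑-single v (t lab i))) ⟩
      edges lab′ ℕ.+ (∑ (t lab v) ℕ.+ ∑ (λ i → t lab i v)) ∎
      where
      open ℕ.≤-Reasoning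
      open Delete lab (Fin._≟ v)
      row col : Fin n → ℕ
      row i = ∑ λ j → 𝟙 (i Fin.≟ v) ℕ.* t lab i j
      col i = ∑ λ j → 𝟙 (j Fin.≟ v) ℕ.* t lab i j
      rows : ∑ row ≡ ∑ (t lab v)
      rows = trans (ℕΣ.∑-comm (λ i j → 𝟙 (i Fin.≟ v) ℕ.* t lab i j))
        (ℕΣ.sum-cong-≗ λ j → ∑-single v (λ i → t lab i j))
      bound : ∀ i j →
        t lab i j ℕ.≤ t lab′ i j ℕ.+ (𝟙 (i Fin.≟ v) ℕ.* t lab i j ℕ.+ 𝟙 (j Fin.≟ v) ℕ.* t lab i j)
      bound i j = cases (i Fin.≟ v) (j Fin.≟ v)
        where
        cases : (p : Dec (i ≡ v)) (q : Dec (j ≡ v)) →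
          t lab i j ℕ.≤ t lab′ i j ℕ.+ (𝟙 p ℕ.* t lab i j ℕ.+ 𝟙 q ℕ.* t lab i j)
        cases (yes _) q = ℕ.≤-trans (ℕ.≤-reflexive (sym (ℕ.*-identityˡ _)))
          (ℕ.≤-trans (ℕ.m≤m+n _ _) (ℕ.m≤n+m _ (t lab′ i j)))
        cases (no _) (yes _) = ℕ.≤-trans (ℕ.≤-reflexive (sym (ℕ.*-identityˡ _))) (ℕ.m≤n+m _ (t lab′ i j))
        cases (no i≢v) (no j≢v) = ℕ.≤-trans (t-kept i j i≢v (λ _ → j≢v)) (ℕ.m≤m+n _ _)

    -- Since no edge leaves `xs`, only the rows of its inner vertices are lost. A vertex is not its
    -- own neighbour, so each such row sums to at most 2l - 1.
    delete-component : ∀ lab xs → length xs ℕ.≤ 2 ℕ.* l →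
      (∀ {v o} → v ∈ xs → E lab v o → o ∈ xs) →
      edges lab ℕ.≤ edges (Delete.lab′ lab (_∈? xs)) ℕ.+ c ℕ.* Delete.Σα lab (_∈? xs)
    delete-component lab xs short closed = begin
      ∑ (λ i → ∑ (t lab i))
        ≤⟨ ∑-mono bound ⟩
      ∑ (λ i → ∑ (t lab′ i) ℕ.+ c ℕ.* (𝟙 (i ∈? xs) ℕ.* α lab i))
        ≡⟨ trans (ℕΣ.∑-distrib-+ (λ i → ∑ (t lab′ i)) _)
             (cong (edges lab′ ℕ.+_) (sym (ℕΣ.*-distribˡ-sum c (λ i → 𝟙 (i ∈? xs) ℕ.* α lab i)))) ⟩
      edges lab′ ℕ.+ c ℕ.* Σα ∎
      where
      open ℕ.≤-Reasoning
      open Delete lab (_∈? xs)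
      e : Fin n → Fin n → ℕ
      e i j = 𝟙 (E? lab i j)
      total≤length : ∀ i ys → total (e i) ys ℕ.≤ length ys
      total≤length i []       = z≤n
      total≤length i (y ∷ ys) = ℕ.+-mono-≤ (𝟙≤1 (E? lab i y)) (total≤length i ys)
      total<length : ∀ {i} ys → i ∈ ys → total (e i) ys ℕ.< length ys
      total<length {i} (y ∷ ys) (here refl)
        = s≤s (ℕ.≤-trans
            (ℕ.≤-reflexive (cong (ℕ._+ total (e i) ys) (𝟙-no (E? lab i i) (E-irrefl lab))))
            (total≤length i ys))
      total<length {i} (y ∷ ys) (there i∈) = ℕ.+-mono-≤-< (𝟙≤1 (E? lab i y)) (total<length ys i∈)
      row≤c : ∀ i → i ∈ xs → ∑ (e i) ℕ.≤ c
      row≤c i i∈ = ℕ.≤-pred (begin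
        suc (∑ (e i))      ≤⟨ s≤s (∑≤total (e i) xs λ j j∉ → 𝟙-no (E? lab i j) (j∉ ∘ closed i∈)) ⟩
        suc (total (e i) xs) ≤⟨ total<length xs i∈ ⟩
        length xs            ≤⟨ short ⟩
        2 ℕ.* l              ≡⟨ 1+c≡2l ⟨
        suc c                ∎)
      bound : ∀ i → ∑ (t lab i) ℕ.≤ ∑ (t lab′ i) ℕ.+ c ℕ.* (𝟙 (i ∈? xs) ℕ.* α lab i)
      bound i = cases (i ∈? xs)
        where
        cases : (d : Dec (i ∈ xs)) → ∑ (t lab i) ℕ.≤ ∑ (t lab′ i) ℕ.+ c ℕ.* (𝟙 d ℕ.* α lab i)
        cases (yes i∈) = ℕ.≤-trans (begin
          ∑ (t lab i)                 ≡⟨ ℕΣ.*-distribˡ-sum (α lab i) (e i) ⟨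
          α lab i ℕ.* ∑ (e i)         ≤⟨ ℕ.*-monoʳ-≤ (α lab i) (row≤c i i∈) ⟩
          α lab i ℕ.* c                 ≡⟨ ℕ.*-comm (α lab i) c ⟩
          c ℕ.* α lab i                 ≡⟨ cong (c ℕ.*_) (ℕ.*-identityˡ (α lab i)) ⟨
          c ℕ.* (1 ℕ.* α lab i)         ∎) (ℕ.m≤n+m _ _)
        cases (no i∉) = ℕ.≤-trans
          (∑-mono λ j → t-kept i j i∉ λ ij j∈ → i∉ (closed j∈ (E-sym lab ij))) (ℕ.m≤m+n _ _)

    -- Induction on a bound `m` for the number of undeleted vertices. Each deletion lowers `edges`
    -- by at most the allowances of the deleted vertices; when none is possible, `A-empty` leaves no
    -- inner vertex and `edges` vanishes.
    edges≤budget : ∀ m lab → size lab ℕ.< m → lab u ≡ deleted → (∀ i → lab i ≡ inner → u ∼ i) →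
      edges lab ℕ.≤ budget lab
    edges≤budget (suc m) lab (s≤s size≤m) u-deleted inner⇒∼ =
      reduce (Fin.any? λ v → inner? (lab v) ×-dec (D.wdeg lab v ℕ.≤? c))
             (Fin.any? λ v → outer? (lab v) ×-dec (D.deg lab v ℕ.≤? l))
      where
      recurse : ∀ {S} (S? : Decidable₁ S) → let open Delete lab S? in
        ∀ {d} → edges lab ℕ.≤ edges lab′ ℕ.+ d → d ℕ.≤ c ℕ.* Σα ℕ.+ l ℕ.* Σβ → 1 ℕ.≤ Σα ℕ.+ Σβ →
        edges lab ℕ.≤ budget lab
      recurse S? {d} lost paid some = begin
        edges lab
          ≤⟨ lost ⟩
        edges lab′ ℕ.+ d
          ≤⟨ ℕ.+-mono-≤ (edges≤budget m lab′ smaller u-deleted′ inner⇒∼′) paid ⟩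
        budget lab′ ℕ.+ (c ℕ.* Σα ℕ.+ l ℕ.* Σβ)
          ≡⟨ budget-split ⟨
        budget lab ∎
        where
        open ℕ.≤-Reasoning
        open Delete lab S?
        smaller : size lab′ ℕ.< m
        smaller = begin-strict
          size lab′                        <⟨ ℕ.≤-reflexive (ℕ.+-comm 1 _) ⟩
          size lab′ ℕ.+ 1                  ≤⟨ ℕ.+-monoʳ-≤ (size lab′) some ⟩
          size lab′ ℕ.+ (Σα ℕ.+ Σβ)        ≡⟨ size-split ⟨
          size lab                         ≤⟨ size≤m ⟩
          m                                ∎
        u-deleted′ : lab′ u ≡ deleted
        u-deleted′ with does (S? u)
        ... | true  = refl
        ... | false = u-deleted
        inner⇒∼′ : ∀ i → lab′ i ≡ inner → u ∼ i
        inner⇒∼′ i with does (S? i)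
        ... | true  = λ ()
        ... | false = inner⇒∼ i

      reduce : Dec (∃ λ v → lab v ≡ inner × D.wdeg lab v ℕ.≤ c) →
        Dec (∃ λ v → lab v ≡ outer × D.deg lab v ℕ.≤ l) →
        edges lab ℕ.≤ budget lab
      reduce (yes (v , v-inner , small)) _ =
        recurse (Fin._≟ v) (delete-vertex lab v) paid
          (ℕ.≤-trans (ℕ.≤-reflexive (sym Σα≡1)) (ℕ.m≤m+n Σα Σβ))
        where
        open Delete lab (Fin._≟ v)
        open ℕ.≤-Reasoning
        open ℕ-Solver.+-*-Solver
        αv≡1 : α lab v ≡ 1
        αv≡1 = 𝟙-yes (inner? (lab v)) v-inner
        Σα≡1 : Σα ≡ 1
        Σα≡1 = trans (∑-single v (α lab)) αv≡1
        -- An edge from `v` to another inner vertex appears both in the row and in the column of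
        -- `v`, hence its double weight.
        pointwise : ∀ j → t lab v j ℕ.+ t lab j v ≡ D.weight lab v j
        pointwise j = trans
          (cong₂ ℕ._+_ (cong (ℕ._* D.e lab v j) αv≡1) (cong (α lab j ℕ.*_) (e-sym lab j v)))
          (solve 2 (λ a e → con 1 :* e :+ a :* e := e :* (con 1 :+ a)) refl (α lab j) (D.e lab v j))
        paid : ∑ (t lab v) ℕ.+ ∑ (λ i → t lab i v) ℕ.≤ c ℕ.* Σα ℕ.+ l ℕ.* Σβ
        paid = begin
          ∑ (t lab v) ℕ.+ ∑ (λ i → t lab i v) ≡⟨ ℕΣ.∑-distrib-+ (t lab v) (λ i → t lab i v) ⟨
          ∑ (λ j → t lab v j ℕ.+ t lab j v)     ≡⟨ ℕΣ.sum-cong-≗ pointwise ⟩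
          D.wdeg lab v                            ≤⟨ small ⟩
          c                                       ≡⟨ ℕ.*-identityʳ c ⟨
          c ℕ.* 1                                 ≡⟨ cong (c ℕ.*_) Σα≡1 ⟨
          c ℕ.* Σα                                ≤⟨ ℕ.m≤m+n _ _ ⟩
          c ℕ.* Σα ℕ.+ l ℕ.* Σβ                   ∎
      reduce (no _) (yes (v , v-outer , small)) =
        recurse (Fin._≟ v) (delete-vertex lab v) paid
          (ℕ.≤-trans (ℕ.≤-reflexive (sym Σβ≡1)) (ℕ.m≤n+m Σβ Σα))
        where
        open Delete lab (Fin._≟ v)
        open ℕ.≤-Reasoning
        Σβ≡1 : Σβ ≡ 1
        Σβ≡1 = trans (∑-single v (β lab)) (𝟙-yes (outer? (lab v)) v-outer)
        αv≡0 : α lab v ≡ 0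
        αv≡0 = 𝟙-no (inner? (lab v)) λ v-inner → case trans (sym v-inner) v-outer of λ ()
        pointwise : ∀ i → t lab i v ℕ.≤ D.e lab v i
        pointwise i = ℕ.≤-trans (ℕ.*-monoˡ-≤ (D.e lab i v) (𝟙≤1 (inner? (lab i))))
          (ℕ.≤-reflexive (trans (ℕ.*-identityˡ _) (e-sym lab i v)))
        paid : ∑ (t lab v) ℕ.+ ∑ (λ i → t lab i v) ℕ.≤ c ℕ.* Σα ℕ.+ l ℕ.* Σβ
        paid = begin
          ∑ (t lab v) ℕ.+ ∑ (λ i → t lab i v)
            ≡⟨ cong (ℕ._+ ∑ (λ i → t lab i v)) (∑-zero λ j → cong (ℕ._* D.e lab v j) αv≡0) ⟩
          ∑ (λ i → t lab i v)       ≤⟨ ∑-mono pointwise ⟩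
          D.deg lab v                 ≤⟨ small ⟩
          l                           ≡⟨ ℕ.*-identityʳ l ⟨
          l ℕ.* 1                     ≡⟨ cong (l ℕ.*_) Σβ≡1 ⟨
          l ℕ.* Σβ                    ≤⟨ ℕ.m≤n+m _ _ ⟩
          c ℕ.* Σα ℕ.+ l ℕ.* Σβ       ∎
      -- Small components are not searched for. The inequality is decidable, so it may be assumed to
      -- fail; a small component with an inner vertex would then prove it by deletion and recursion.
      reduce (no ¬sparse-inner) (no ¬sparse-outer) = decidable-stable (edges lab ℕ.≤? budget lab) λ ¬≤ →
        ¬≤ (ℕ.≤-trans (ℕ.≤-reflexive (no-edges
          (D.A-empty lab inner-dense outer-dense no-path (no-closed ¬≤)))) z≤n)
        where
        inner-dense : ∀ {a} → lab a ≡ inner → 2 ℕ.* l ℕ.≤ D.wdeg lab a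
        inner-dense {a} a-inner = ℕ.≤-trans (ℕ.≤-reflexive (sym 1+c≡2l))
          (ℕ.≰⇒> λ small → ¬sparse-inner (a , a-inner , small))
        outer-dense : ∀ {b v} → lab b ≢ inner → E lab b v → l ℕ.< D.deg lab b
        outer-dense {b} {v} b≢ (_ , j) =
          ℕ.≰⇒> λ small → ¬sparse-outer (b , joined⇒outer (lab b) (lab v) j b≢ , small)
        forget : ∀ {x xs y} → Walk (E lab) x xs y → Walk _∼_ x xs y
        forget [ x ]         = [ x ]
        forget ((xy , _) ∷ w) = xy ∷ forget w
        avoid : ∀ {x xs y} → lab x ≢ deleted → Walk (E lab) x xs y → u ∉ xs
        avoid x≢ [ _ ]   (here refl) = x≢ u-deleted
        avoid x≢ (_ ∷ _) (here refl) = x≢ u-deleted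
        avoid x≢ (_∷_ {x} {y} (_ , j) w) (there u∈) = avoid (joined≢deleted (lab x) (lab y) j) w u∈
        no-path : NoPath (E lab) ((_≡ inner) ∘ lab) (suc (2 ℕ.* l))
        no-path {x} {y = y} w uniq x-inner y-inner = no-cycle (forget w)
          (avoid (λ x-del → case trans (sym x-inner) x-del of λ ()) w ∷ᵘ uniq)
          (inner⇒∼ x x-inner) (inner⇒∼ y y-inner)
        no-closed : ¬ edges lab ℕ.≤ budget lab → ∀ {xs a} → length xs ℕ.≤ 2 ℕ.* l → lab a ≡ inner → a ∈ xs →
          ¬ (∀ {v o} → v ∈ xs → E lab v o → o ∈ xs)
        no-closed ¬≤ {xs} {a} short a-inner a∈ closed = ¬≤ (recurse (_∈? xs)
          (delete-component lab xs short closed) (ℕ.m≤m+n _ _) (ℕ.≤-trans some (ℕ.m≤m+n Σα Σβ)))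
          where
          open Delete lab (_∈? xs)
          open ℕ.≤-Reasoning
          some : 1 ℕ.≤ Σα
          some = begin
            1
              ≡⟨ cong₂ ℕ._*_ (𝟙-yes (a ∈? xs) a∈) (𝟙-yes (inner? (lab a)) a-inner) ⟨
            𝟙 (a ∈? xs) ℕ.* α lab a
              ≡⟨ ∑-single a (λ i → 𝟙 (i ∈? xs) ℕ.* α lab i) ⟨
            ∑ (λ i → 𝟙 (i Fin.≟ a) ℕ.* (𝟙 (i ∈? xs) ℕ.* α lab i))
              ≤⟨ ∑-mono (λ i → ℕ.≤-trans (ℕ.*-monoˡ-≤ _ (𝟙≤1 (i Fin.≟ a)))
                   (ℕ.≤-reflexive (ℕ.*-identityˡ _))) ⟩
            Σα ∎
        no-edges : (∀ {a} → lab a ≢ inner) → edges lab ≡ 0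
        no-edges none = ∑-zero λ i → ∑-zero λ j → cong (ℕ._* D.e lab i j) (𝟙-no (inner? (lab i)) none)

    -- The left side counts walks of length two from `u`: those returning to `u` number `degree u`,
    -- and the others are counted by `edges`. With d the degree, (2l - 1)d + l|B| + d = ld + l(d +
    -- |B|), and `u` itself lies in neither part, so d + |B| is at most n - 1.
    two-walks : ∀ {n′} → n ≡ suc n′ →
      ∑ (λ i → g u i ℕ.* degree i) ℕ.≤ l ℕ.* degree u ℕ.+ l ℕ.* n′
    two-walks {n′} n≡ = begin
      ∑ (λ i → g u i ℕ.* degree i)
        ≡⟨ ℕΣ.sum-cong-≗ (λ i → ℕΣ.*-distribˡ-sum (g u i) (g i)) ⟩
      ∑ (λ i → ∑ λ j → g u i ℕ.* g i j)
        ≤⟨ ∑-mono (λ i → ∑-mono (bound i)) ⟩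
      ∑ (λ i → ∑ λ j → t lab i j ℕ.+ 𝟙 (j Fin.≟ u) ℕ.* g u i)
        ≡⟨ ℕΣ.sum-cong-≗ (λ i → trans (ℕΣ.∑-distrib-+ (t lab i) _)
             (cong (∑ (t lab i) ℕ.+_) (∑-single u (λ _ → g u i)))) ⟩
      ∑ (λ i → ∑ (t lab i) ℕ.+ g u i)
        ≡⟨ ℕΣ.∑-distrib-+ (λ i → ∑ (t lab i)) (g u) ⟩
      edges lab ℕ.+ degree u
        ≤⟨ ℕ.+-monoˡ-≤ (degree u) (edges≤budget (suc (size lab)) lab ℕ.≤-refl u-deleted inner⇒∼) ⟩
      c ℕ.* ∑ (α lab) ℕ.+ l ℕ.* ∑ (β lab) ℕ.+ degree u
        ≡⟨ cong (λ a → c ℕ.* a ℕ.+ l ℕ.* ∑ (β lab) ℕ.+ degree u) ∑-α ⟩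
      c ℕ.* degree u ℕ.+ l ℕ.* ∑ (β lab) ℕ.+ degree u
        ≡⟨ solve 4 (λ c d l b → c :* d :+ l :* b :+ d := (con 1 :+ c) :* d :+ l :* b) refl
             c (degree u) l (∑ (β lab)) ⟩
      suc c ℕ.* degree u ℕ.+ l ℕ.* ∑ (β lab)
        ≡⟨ cong (λ a → a ℕ.* degree u ℕ.+ l ℕ.* ∑ (β lab)) 1+c≡2l ⟩
      2 ℕ.* l ℕ.* degree u ℕ.+ l ℕ.* ∑ (β lab)
        ≡⟨ solve 3 (λ d l b → con 2 :* l :* d :+ l :* b := l :* d :+ l :* (d :+ b)) refl
             (degree u) l (∑ (β lab)) ⟩
      l ℕ.* degree u ℕ.+ l ℕ.* (degree u ℕ.+ ∑ (β lab))
        ≤⟨ ℕ.+-monoʳ-≤ (l ℕ.* degree u) (ℕ.*-monoʳ-≤ l others) ⟩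
      l ℕ.* degree u ℕ.+ l ℕ.* n′ ∎
      where
      open ℕ.≤-Reasoning
      open ℕ-Solver.+-*-Solver
      lab : Fin n → Label
      lab i = if does (i Fin.≟ u) then deleted else (if does (u ∼? i) then inner else outer)
      u-deleted : lab u ≡ deleted
      u-deleted with u Fin.≟ u
      ... | yes _  = refl
      ... | no u≢u = ⊥-elim (u≢u refl)
      inner⇒∼ : ∀ i → lab i ≡ inner → u ∼ i
      inner⇒∼ i with i Fin.≟ u | u ∼? i
      ... | yes _ | _      = λ ()
      ... | no _  | yes ui = λ _ → ui
      ... | no _  | no _   = λ ()
      ∼⇒inner : ∀ i → u ∼ i → lab i ≡ inner
      ∼⇒inner i ui with i Fin.≟ u | u ∼? i
      ... | yes refl | _     = ⊥-elim (irrefl refl ui)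
      ... | no _  | yes _  = refl
      ... | no _  | no ¬ui = ⊥-elim (¬ui ui)
      ∑-α : ∑ (α lab) ≡ degree u
      ∑-α = ℕΣ.sum-cong-≗ λ i → ℕ.≤-antisym (𝟙-mono (inner? (lab i)) (u ∼? i) (inner⇒∼ i))
                                           (𝟙-mono (u ∼? i) (inner? (lab i)) (∼⇒inner i))
      others : degree u ℕ.+ ∑ (β lab) ℕ.≤ n′
      others = ℕ.≤-pred (begin
        suc (degree u ℕ.+ ∑ (β lab))
          ≡⟨ cong₂ (λ a d → a ℕ.+ (d ℕ.+ ∑ (β lab))) (∑-single u (λ _ → 1)) ∑-α ⟨
        ∑ (λ i → 𝟙 (i Fin.≟ u) ℕ.* 1) ℕ.+ (∑ (α lab) ℕ.+ ∑ (β lab))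
          ≡⟨ trans (ℕΣ.∑-distrib-+ (λ i → 𝟙 (i Fin.≟ u) ℕ.* 1) _)
               (cong (∑ (λ i → 𝟙 (i Fin.≟ u) ℕ.* 1) ℕ.+_) (ℕΣ.∑-distrib-+ (α lab) (β lab))) ⟨
        ∑ (λ i → 𝟙 (i Fin.≟ u) ℕ.* 1 ℕ.+ (α lab i ℕ.+ β lab i))
          ≤⟨ ∑-mono one ⟩
        ∑ {n} (λ _ → 1)
          ≡⟨ trans (∑-const n) (ℕ.*-identityʳ n) ⟩
        n
          ≡⟨ n≡ ⟩
        suc n′ ∎)
        where
        one : ∀ i → 𝟙 (i Fin.≟ u) ℕ.* 1 ℕ.+ (α lab i ℕ.+ β lab i) ℕ.≤ 1
        one i with i Fin.≟ u | u ∼? i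
        ... | yes _ | _     = ℕ.≤-refl
        ... | no _  | yes _ = ℕ.≤-refl
        ... | no _  | no _  = ℕ.≤-refl
      bound : ∀ i j → g u i ℕ.* g i j ℕ.≤ t lab i j ℕ.+ 𝟙 (j Fin.≟ u) ℕ.* g u i
      bound i j = cases (u ∼? i) (i ∼? j) (j Fin.≟ u)
        where
        cases : (p : Dec (u ∼ i)) (q : Dec (i ∼ j)) (r : Dec (j ≡ u)) →
          𝟙 p ℕ.* 𝟙 q ℕ.≤ t lab i j ℕ.+ 𝟙 r ℕ.* 𝟙 p
        cases (no _)   _        _        = z≤n
        cases (yes _)  (no _)   _        = z≤n
        cases (yes _)  (yes _)  (yes _)  = ℕ.m≤n+m 1 (t lab i j)
        cases (yes ui) (yes ij) (no j≢u) = ℕ.≤-trans (ℕ.≤-reflexive (sym (cong₂ ℕ._*_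
            (𝟙-yes (inner? (lab i)) i-inner) (𝟙-yes (E? lab i j) (ij , ij-joined))))) (ℕ.m≤m+n _ _)
          where
          i-inner = ∼⇒inner i ui
          kept : lab j ≢ deleted
          kept with j Fin.≟ u | u ∼? j
          ... | yes j≡u | _     = ⊥-elim (j≢u j≡u)
          ... | no _    | yes _ = λ ()
          ... | no _    | no _  = λ ()
          ij-joined : Joined (lab i) (lab j)
          ij-joined rewrite i-inner with lab j | kept
          ... | inner   | _ = tt
          ... | outer   | _ = tt
          ... | deleted | k = k refl

-- Cycles

lookup-injective : ∀ {n} {xs : List (Fin n)} → Unique xs → Injective _≡_ _≡_ (lookup xs)
lookup-injective {xs = x ∷ xs} u {zero}  {zero}  eq = refl
lookup-injective {xs = x ∷ xs} u {zero}  {suc j} eq =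
  ⊥-elim (Unique[x∷xs]⇒x∉xs u (subst (_∈ xs) (sym eq) (∈-lookup j)))
lookup-injective {xs = x ∷ xs} u {suc i} {zero}  eq =
  ⊥-elim (Unique[x∷xs]⇒x∉xs u (subst (_∈ xs) eq (∈-lookup i)))
lookup-injective {xs = x ∷ xs} u {suc i} {suc j} eq = cong suc (lookup-injective (Unique-tail u) eq)

any-vec? : ∀ {n} m {P : Vec (Fin n) m → Set} → (∀ v → Dec (P v)) → Dec (∃ P)
any-vec? zero    P? = map′ ([] ,_) (λ { ([] , p) → p }) (P? [])
any-vec? (suc m) P? = map′ (λ { (x , v , p) → x ∷ v , p }) (λ { (x ∷ v , p) → x , v , p })
  (Fin.any? λ x → any-vec? m (P? ∘ (x ∷_)))

-- The spectral side only produces a contradiction; decidable containment turns it into a cycle.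
-- Maps are represented by vectors, over which an exhaustive search is possible.
_⊇?_ : ∀ {n m} (G : Graph n) (H : Graph m) → Dec (G ⊇ H)
_⊇?_ {n} {m} G H = map′
  (λ (v , inj , hom) → Vec.lookup v , (λ {i} {j} → inj i j) , (λ {i} {j} → hom i j))
  (λ (f , inj , hom) → tabulate f
    , (λ i j eq → inj (trans (sym (Vec.lookup∘tabulate f i)) (trans eq (Vec.lookup∘tabulate f j))))
    , (λ i j ij → subst₂ G._∼_ (sym (Vec.lookup∘tabulate f i)) (sym (Vec.lookup∘tabulate f j)) (hom ij)))
  (any-vec? m λ v →
    Fin.all? (λ i → Fin.all? λ j → (Vec.lookup v i Fin.≟ Vec.lookup v j) →-dec (i Fin.≟ j)) ×-dec
    Fin.all? (λ i → Fin.all? λ j → (i H.∼? j) →-dec (Vec.lookup v i G.∼? Vec.lookup v j)))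
  where
  module G = Graph G
  module H = Graph H

module _ {n} (G : Graph n) where
  open Graph G

  walk-next : ∀ {x xs y} → Walk _∼_ x xs y → ∀ i j → suc (toℕ i) ≡ toℕ j → lookup xs i ∼ lookup xs j
  walk-next [ x ] zero zero ()
  walk-next (e ∷ w) zero (suc j) eq = subst (_ ∼_) (first w j (sym (ℕ.suc-injective eq))) e
    where
    first : ∀ {x xs y} → Walk _∼_ x xs y → ∀ j → toℕ j ≡ 0 → x ≡ lookup xs j
    first [ _ ]   zero _ = refl
    first (_ ∷ _) zero _ = refl
  walk-next (e ∷ w) (suc i) (suc j) eq = walk-next w i j (ℕ.suc-injective eq)

  walk-last : ∀ {x xs y} → Walk _∼_ x xs y → ∀ i → suc (toℕ i) ≡ length xs → lookup xs i ≡ y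
  walk-last [ _ ]   zero    _  = refl
  walk-last (_ ∷ [ _ ])   zero ()
  walk-last (_ ∷ (_ ∷ _)) zero ()
  walk-last (_ ∷ w) (suc i) eq = walk-last w i (ℕ.suc-injective eq)

  closed-walk⇒cycle : ∀ {u x xs y} → Walk _∼_ x xs y → Unique (u ∷ xs) → u ∼ x → u ∼ y →
    G ⊇ C (length (u ∷ xs))
  closed-walk⇒cycle {u} {x} {xs} {y} w uniq ux uy = lookup (u ∷ xs) , lookup-injective uniq , adjacent
    where
    next : ∀ i j → IsNext i j → lookup (u ∷ xs) i ∼ lookup (u ∷ xs) j
    next i j    (inj₁ eq) = walk-next (ux ∷ w) i j eq
    next i zero (inj₂ (eq , _)) = subst (_∼ u) (sym (walk-last (ux ∷ w) i eq)) (symm uy)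
    adjacent : ∀ {i j} → Graph._∼_ (C (length (u ∷ xs))) i j → lookup (u ∷ xs) i ∼ lookup (u ∷ xs) j
    adjacent {i} {j} (_ , inj₁ i→j) = next i j i→j
    adjacent {i} {j} (_ , inj₂ j→i) = symm (next j i j→i)

-- The spectral bound

-- Reduces an inequality to a ring identity for the solver, with `d` assembled from terms known to
-- be nonnegative.
≤-from-difference : ∀ {p q d} → 0ℚ ℚ.≤ d → d ≡ q ℚ.- p → p ℚ.≤ q
≤-from-difference {p} {q} 0≤d refl =
  subst₂ ℚ._≤_ (ℚ.+-identityʳ p) (solve 2 (λ p q → p :+ (q :- p) := q) refl p q) (ℚ.+-monoʳ-≤ p 0≤d)
  where open ℚ-Solver.+-*-Solver

difference≥0 : ∀ {p q} → p ℚ.≤ q → 0ℚ ℚ.≤ q ℚ.- p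
difference≥0 {p} {q} p≤q = subst (ℚ._≤ q ℚ.- p) (ℚ.+-inverseʳ p) (ℚ.+-monoˡ-≤ (ℚ.- p) p≤q)

+-≥0 : ∀ {p q} → 0ℚ ℚ.≤ p → 0ℚ ℚ.≤ q → 0ℚ ℚ.≤ p ℚ.+ q
+-≥0 = ℚ.+-mono-≤

*-≥0 : ∀ {p q} → 0ℚ ℚ.≤ p → 0ℚ ℚ.≤ q → 0ℚ ℚ.≤ p ℚ.* q
*-≥0 {p} {q} 0≤p 0≤q = subst (ℚ._≤ p ℚ.* q) (ℚ.*-zeroʳ p) (ℚ.*-monoˡ-≤-nonNeg p {{ℚ.nonNegative 0≤p}} 0≤q)

*-monoˡ-≤ : ∀ {r p q} → 0ℚ ℚ.≤ r → p ℚ.≤ q → r ℚ.* p ℚ.≤ r ℚ.* q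
*-monoˡ-≤ {r} 0≤r = ℚ.*-monoˡ-≤-nonNeg r {{ℚ.nonNegative 0≤r}}

*->0 : ∀ {p q} → 0ℚ ℚ.< p → 0ℚ ℚ.< q → 0ℚ ℚ.< p ℚ.* q
*->0 {p} {q} 0<p 0<q = ℚ.positive⁻¹ (p ℚ.* q) {{ℚ.pos*pos⇒pos p {{ℚ.positive 0<p}} q {{ℚ.positive 0<q}}}}

p≤∣p∣ : ∀ p → p ℚ.≤ ∣ p ∣
p≤∣p∣ p with ℚ.≤-total 0ℚ p
... | inj₁ 0≤p = ℚ.≤-reflexive (sym (ℚ.0≤p⇒∣p∣≡p 0≤p))
... | inj₂ p≤0 = ℚ.≤-trans p≤0 (ℚ.0≤∣p∣ p)

∣-∣≤⇒ˡ : ∀ p q {d} → ∣ p ℚ.- q ∣ ℚ.≤ d → p ℚ.≤ q ℚ.+ d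
∣-∣≤⇒ˡ p q {d} h = subst (ℚ._≤ q ℚ.+ d) (solve 2 (λ p q → q :+ (p :- q) := p) refl p q)
  (ℚ.+-monoʳ-≤ q (ℚ.≤-trans (p≤∣p∣ (p ℚ.- q)) h))
  where open ℚ-Solver.+-*-Solver

∣-∣≤⇒ʳ : ∀ p q {d} → ∣ p ℚ.- q ∣ ℚ.≤ d → q ℚ.≤ p ℚ.+ d
∣-∣≤⇒ʳ p q {d} h = ∣-∣≤⇒ˡ q p (subst (ℚ._≤ d)
  (trans (sym (ℚ.∣-p∣≡∣p∣ (p ℚ.- q))) (cong ∣_∣ (solve 2 (λ p q → :- (p :- q) := q :- p) refl p q))) h)
  where open ℚ-Solver.+-*-Solver

-- Naturals and fractions inside the rationals

fromℚᵘ-homo-+ : ∀ p q → fromℚᵘ (p ℚᵘ.+ q) ≡ fromℚᵘ p ℚ.+ fromℚᵘ q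
fromℚᵘ-homo-+ p q = trans
  (ℚ.fromℚᵘ-cong (ℚᵘ.≃-sym (ℚᵘ.≃-trans (ℚ.toℚᵘ-homo-+ (fromℚᵘ p) (fromℚᵘ q))
    (ℚᵘ.+-cong (ℚ.toℚᵘ-fromℚᵘ p) (ℚ.toℚᵘ-fromℚᵘ q)))))
  (ℚ.fromℚᵘ-toℚᵘ _)

fromℚᵘ-homo-* : ∀ p q → fromℚᵘ (p ℚᵘ.* q) ≡ fromℚᵘ p ℚ.* fromℚᵘ q
fromℚᵘ-homo-* p q = trans
  (ℚ.fromℚᵘ-cong (ℚᵘ.≃-sym (ℚᵘ.≃-trans (ℚ.toℚᵘ-homo-* (fromℚᵘ p) (fromℚᵘ q))
    (ℚᵘ.*-cong (ℚ.toℚᵘ-fromℚᵘ p) (ℚ.toℚᵘ-fromℚᵘ q)))))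
  (ℚ.fromℚᵘ-toℚᵘ _)

toℚ : ℕ → ℚ
toℚ m = + m / 1

-- Checked on unnormalised fractions, where equality is a cross-multiplied integer identity.
toℚ-+ : ∀ a b → toℚ (a ℕ.+ b) ≡ toℚ a ℚ.+ toℚ b
toℚ-+ a b = trans
  (ℚ.fromℚᵘ-cong {mkℚᵘ (+ (a ℕ.+ b)) 0} {mkℚᵘ (+ a) 0 ℚᵘ.+ mkℚᵘ (+ b) 0}
    (*≡* (solve 2 (λ a b → (a :+ b) :* con (+ 1) := (a :* con (+ 1) :+ b :* con (+ 1)) :* con (+ 1))
      refl (+ a) (+ b))))
  (fromℚᵘ-homo-+ (mkℚᵘ (+ a) 0) (mkℚᵘ (+ b) 0))
  where open ℤ-Solver.+-*-Solver

toℚ-* : ∀ a b → toℚ (a ℕ.* b) ≡ toℚ a ℚ.* toℚ b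
toℚ-* a b = trans
  (ℚ.fromℚᵘ-cong {mkℚᵘ (+ (a ℕ.* b)) 0} {mkℚᵘ (+ a) 0 ℚᵘ.* mkℚᵘ (+ b) 0}
    (*≡* (cong (ℤ._* + 1) (ℤ.pos-* a b))))
  (fromℚᵘ-homo-* (mkℚᵘ (+ a) 0) (mkℚᵘ (+ b) 0))

toℚ≥0 : ∀ a → 0ℚ ℚ.≤ toℚ a
toℚ≥0 a = ℚ.nonNegative⁻¹ (toℚ a) {{ℚ.normalize-nonNeg a 1}}

toℚ-mono : ∀ {a b} → a ℕ.≤ b → toℚ a ℚ.≤ toℚ b
toℚ-mono {a} {b} a≤b = ≤-from-difference (toℚ≥0 (b ℕ.∸ a)) (begin
  toℚ (b ℕ.∸ a)                        ≡⟨ solve 2 (λ x y → x := y :+ x :- y) refl (toℚ (b ℕ.∸ a)) (toℚ a) ⟩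
  toℚ a ℚ.+ toℚ (b ℕ.∸ a) ℚ.- toℚ a    ≡⟨ cong (ℚ._- toℚ a) (toℚ-+ a (b ℕ.∸ a)) ⟨
  toℚ (a ℕ.+ (b ℕ.∸ a)) ℚ.- toℚ a      ≡⟨ cong (λ c → toℚ c ℚ.- toℚ a) (ℕ.m+[n∸m]≡n a≤b) ⟩
  toℚ b ℚ.- toℚ a                      ∎)
  where
  open ≡-Reasoning
  open ℚ-Solver.+-*-Solver

toℚ-sum : ∀ {n} (f : Fin n → ℕ) → toℚ (∑ f) ≡ ℚΣ.sum (toℚ ∘ f)
toℚ-sum {zero}  f = refl
toℚ-sum {suc n} f = trans (toℚ-+ (f zero) _) (cong (toℚ (f zero) ℚ.+_) (toℚ-sum (f ∘ suc)))

half-double : ∀ k → + k / 2 ℚ.+ + k / 2 ≡ toℚ k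
half-double k = trans (sym (fromℚᵘ-homo-+ (mkℚᵘ (+ k) 1) (mkℚᵘ (+ k) 1)))
  (ℚ.fromℚᵘ-cong {mkℚᵘ (+ k) 1 ℚᵘ.+ mkℚᵘ (+ k) 1} {mkℚᵘ (+ k) 0}
    (*≡* (solve 1 (λ k → (k :* con (+ 2) :+ k :* con (+ 2)) :* con (+ 1) := k :* con (+ 4)) refl (+ k))))
  where open ℤ-Solver.+-*-Solver

half-square : ∀ k → (+ k ℤ.* + k ℤ.- + 4 ℤ.* + k) / 4 ℚ.+ toℚ k ≡ + k / 2 ℚ.* (+ k / 2)
half-square k = trans (sym (fromℚᵘ-homo-+ (mkℚᵘ (+ k ℤ.* + k ℤ.- + 4 ℤ.* + k) 3) (mkℚᵘ (+ k) 0)))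
  (trans
    (ℚ.fromℚᵘ-cong
      {mkℚᵘ (+ k ℤ.* + k ℤ.- + 4 ℤ.* + k) 3 ℚᵘ.+ mkℚᵘ (+ k) 0} {mkℚᵘ (+ k) 1 ℚᵘ.* mkℚᵘ (+ k) 1}
      (*≡* (solve 1 (λ k → ((k :* k :- con (+ 4) :* k) :* con (+ 1) :+ k :* con (+ 4)) :* con (+ 4)
                           := (k :* k) :* con (+ 4)) refl (+ k))))
    (fromℚᵘ-homo-* (mkℚᵘ (+ k) 1) (mkℚᵘ (+ k) 1)))
  where open ℤ-Solver.+-*-Solver

-- In the form kn + (k/2)^2, with n one less than the order, the radicand is below p^2 exactly when
-- (p + k/2)(p - k/2) exceeds kn.
radicand : ∀ k n → toℚ (k ℕ.* suc n) ℚ.+ (+ k ℤ.* + k ℤ.- + 4 ℤ.* + k) / 4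
                   ≡ toℚ k ℚ.* toℚ n ℚ.+ + k / 2 ℚ.* (+ k / 2)
radicand k n = begin
  toℚ (k ℕ.* suc n) ℚ.+ i/4
    ≡⟨ cong (λ m → toℚ m ℚ.+ i/4) (ℕ.*-suc k n) ⟩
  toℚ (k ℕ.+ k ℕ.* n) ℚ.+ i/4
    ≡⟨ cong (ℚ._+ i/4) (trans (toℚ-+ k (k ℕ.* n)) (cong (toℚ k ℚ.+_) (toℚ-* k n))) ⟩
  toℚ k ℚ.+ toℚ k ℚ.* toℚ n ℚ.+ i/4
    ≡⟨ solve 3 (λ k a i → k :+ a :+ i := a :+ (i :+ k)) refl (toℚ k) (toℚ k ℚ.* toℚ n) i/4 ⟩
  toℚ k ℚ.* toℚ n ℚ.+ (i/4 ℚ.+ toℚ k)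
    ≡⟨ cong (toℚ k ℚ.* toℚ n ℚ.+_) (half-square k) ⟩
  toℚ k ℚ.* toℚ n ℚ.+ + k / 2 ℚ.* (+ k / 2) ∎
  where
  open ≡-Reasoning
  open ℚ-Solver.+-*-Solver
  i/4 = (+ k ℤ.* + k ℤ.- + 4 ℤ.* + k) / 4

-- Finite sums of rationals

sum-mono-≤ : ∀ {n} {f h : Fin n → ℚ} → (∀ i → f i ℚ.≤ h i) → ℚΣ.sum f ℚ.≤ ℚΣ.sum h
sum-mono-≤ {zero}  f≤h = ℚ.≤-refl
sum-mono-≤ {suc n} f≤h = ℚ.+-mono-≤ (f≤h zero) (sum-mono-≤ (f≤h ∘ suc))

sum≥0 : ∀ {n} {f : Fin n → ℚ} → (∀ i → 0ℚ ℚ.≤ f i) → 0ℚ ℚ.≤ ℚΣ.sum f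
sum≥0 {zero}  0≤f = ℚ.≤-refl
sum≥0 {suc n} 0≤f = +-≥0 (0≤f zero) (sum≥0 (0≤f ∘ suc))

term≤sum : ∀ {n} {f : Fin n → ℚ} → (∀ i → 0ℚ ℚ.≤ f i) → ∀ i → f i ℚ.≤ ℚΣ.sum f
term≤sum {suc n} {f} 0≤f zero = subst (ℚ._≤ ℚΣ.sum f) (ℚ.+-identityʳ (f zero))
  (ℚ.+-monoʳ-≤ (f zero) (sum≥0 (0≤f ∘ suc)))
term≤sum {suc n} {f} 0≤f (suc i) = ℚ.≤-trans (term≤sum (0≤f ∘ suc) i)
  (subst (ℚ._≤ ℚΣ.sum f) (ℚ.+-identityˡ _) (ℚ.+-monoˡ-≤ _ (0≤f zero)))

∣sum∣≤ : ∀ {n} (f : Fin n → ℚ) → ∣ ℚΣ.sum f ∣ ℚ.≤ ℚΣ.sum (λ i → ∣ f i ∣)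
∣sum∣≤ {zero}  f = ℚ.≤-refl
∣sum∣≤ {suc n} f = ℚ.≤-trans (ℚ.∣p+q∣≤∣p∣+∣q∣ (f zero) _) (ℚ.+-monoʳ-≤ ∣ f zero ∣ (∣sum∣≤ (f ∘ suc)))

-- A positive z with a z ≤ r z certifies that no approximate eigenvalue of the
-- nonnegative symmetric matrix a exceeds r.
eigenvector-bound : ∀ {n} (a : Fin n → Fin n → ℚ) (z x : Fin n → ℚ) {r t ε m δ : ℚ} →
  (∀ i j → 0ℚ ℚ.≤ a i j) → (∀ i j → a i j ≡ a j i) →
  0ℚ ℚ.≤ t → (∀ i → t ℚ.≤ z i) → (∀ i → ℚΣ.sum (λ j → a i j ℚ.* z j) ℚ.≤ r ℚ.* z i) →
  0ℚ ℚ.≤ ε → r ℚ.+ ε ℚ.≤ m →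
  (∀ i → ∣ ℚΣ.sum (λ j → a i j ℚ.* x j) ℚ.- m ℚ.* x i ∣ ℚ.≤ δ) →
  ∀ i → ε ℚ.* t ℚ.* ∣ x i ∣ ℚ.≤ δ ℚ.* ℚΣ.sum z
eigenvector-bound {n} a z x {r} {t} {ε} {m} {δ} a≥0 a-sym 0≤t t≤z az≤rz 0≤ε r+ε≤m near i = begin
  ε ℚ.* t ℚ.* y i             ≡⟨ ℚ.*-assoc ε t (y i) ⟩
  ε ℚ.* (t ℚ.* y i)           ≤⟨ *-monoˡ-≤ 0≤ε (ℚ.*-monoʳ-≤-nonNeg (y i) {{ℚ.nonNegative (y≥0 i)}} (t≤z i)) ⟩
  ε ℚ.* (z i ℚ.* y i)         ≤⟨ *-monoˡ-≤ 0≤ε (term≤sum (λ i → *-≥0 (z≥0 i) (y≥0 i)) i) ⟩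
  ε ℚ.* S                     ≤⟨ ≤-from-difference (difference≥0 summed)
                                   (solve 4 (λ r ε S d → (r :* S :+ d) :- (r :+ ε) :* S := d :- ε :* S)
                                     refl r ε S (δ ℚ.* ℚΣ.sum z)) ⟩
  δ ℚ.* ℚΣ.sum z              ∎
  where
  open ℚ.≤-Reasoning
  open ℚ-Solver.+-*-Solver
  y : Fin n → ℚ
  y i = ∣ x i ∣
  y≥0 : ∀ i → 0ℚ ℚ.≤ y i
  y≥0 i = ℚ.0≤∣p∣ (x i)
  z≥0 : ∀ i → 0ℚ ℚ.≤ z i
  z≥0 i = ℚ.≤-trans 0≤t (t≤z i)
  S = ℚΣ.sum λ i → z i ℚ.* y i
  row : ∀ i → (r ℚ.+ ε) ℚ.* y i ℚ.≤ ℚΣ.sum (λ j → a i j ℚ.* y j) ℚ.+ δ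
  row i = begin
    (r ℚ.+ ε) ℚ.* y i
      ≤⟨ ℚ.*-monoʳ-≤-nonNeg (y i) {{ℚ.nonNegative (y≥0 i)}} (ℚ.≤-trans r+ε≤m (p≤∣p∣ m)) ⟩
    ∣ m ∣ ℚ.* y i
      ≡⟨ ℚ.∣p*q∣≡∣p∣*∣q∣ m (x i) ⟨
    ∣ m ℚ.* x i ∣
      ≡⟨ cong ∣_∣ (solve 2 (λ p q → p := q :- (q :- p)) refl (m ℚ.* x i) ax) ⟩
    ∣ ax ℚ.- (ax ℚ.- m ℚ.* x i) ∣
      ≤⟨ ℚ.∣p-q∣≤∣p∣+∣q∣ ax _ ⟩
    ∣ ax ∣ ℚ.+ ∣ ax ℚ.- m ℚ.* x i ∣
      ≤⟨ ℚ.+-mono-≤ (ℚ.≤-trans (∣sum∣≤ (λ j → a i j ℚ.* x j)) (ℚ.≤-reflexive (ℚΣ.sum-cong-≗ abs)))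
           (near i) ⟩
    ℚΣ.sum (λ j → a i j ℚ.* y j) ℚ.+ δ ∎
    where
    ax = ℚΣ.sum λ j → a i j ℚ.* x j
    abs : ∀ j → ∣ a i j ℚ.* x j ∣ ≡ a i j ℚ.* y j
    abs j = trans (ℚ.∣p*q∣≡∣p∣*∣q∣ (a i j) (x j)) (cong (ℚ._* y j) (ℚ.0≤p⇒∣p∣≡p (a≥0 i j)))
  -- The inequalities `row` are paired with `z`. By symmetry, pairing `z` with `a y` is pairing `y`
  -- with `a z`, which is at most r S.
  summed : (r ℚ.+ ε) ℚ.* S ℚ.≤ r ℚ.* S ℚ.+ δ ℚ.* ℚΣ.sum z
  summed = begin
    (r ℚ.+ ε) ℚ.* S
      ≡⟨ ℚΣ.*-distribˡ-sum (r ℚ.+ ε) (λ i → z i ℚ.* y i) ⟩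
    ℚΣ.sum (λ i → (r ℚ.+ ε) ℚ.* (z i ℚ.* y i))
      ≤⟨ sum-mono-≤ (λ i → ℚ.≤-trans (ℚ.≤-reflexive (swap (r ℚ.+ ε) (z i) (y i)))
           (*-monoˡ-≤ (z≥0 i) (row i))) ⟩
    ℚΣ.sum (λ i → z i ℚ.* (ℚΣ.sum (λ j → a i j ℚ.* y j) ℚ.+ δ))
      ≡⟨ ℚΣ.sum-cong-≗ (λ i → trans (ℚ.*-distribˡ-+ (z i) _ δ)
           (cong₂ ℚ._+_ (ℚΣ.*-distribˡ-sum (z i) (λ j → a i j ℚ.* y j)) (ℚ.*-comm (z i) δ))) ⟩
    ℚΣ.sum (λ i → ℚΣ.sum (λ j → z i ℚ.* (a i j ℚ.* y j)) ℚ.+ δ ℚ.* z i)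
      ≡⟨ ℚΣ.∑-distrib-+ (λ i → ℚΣ.sum (λ j → z i ℚ.* (a i j ℚ.* y j))) (λ i → δ ℚ.* z i) ⟩
    ℚΣ.sum (λ i → ℚΣ.sum (λ j → z i ℚ.* (a i j ℚ.* y j))) ℚ.+ ℚΣ.sum (λ i → δ ℚ.* z i)
      ≡⟨ cong₂ ℚ._+_ transpose (sym (ℚΣ.*-distribˡ-sum δ z)) ⟩
    ℚΣ.sum (λ j → y j ℚ.* ℚΣ.sum (λ i → a j i ℚ.* z i)) ℚ.+ δ ℚ.* ℚΣ.sum z
      ≤⟨ ℚ.+-monoˡ-≤ (δ ℚ.* ℚΣ.sum z) (sum-mono-≤ λ j → *-monoˡ-≤ (y≥0 j) (az≤rz j)) ⟩
    ℚΣ.sum (λ j → y j ℚ.* (r ℚ.* z j)) ℚ.+ δ ℚ.* ℚΣ.sum z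
      ≡⟨ cong (ℚ._+ δ ℚ.* ℚΣ.sum z) (trans (ℚΣ.sum-cong-≗ λ j → cyc (y j) r (z j))
           (sym (ℚΣ.*-distribˡ-sum r (λ i → z i ℚ.* y i)))) ⟩
    r ℚ.* S ℚ.+ δ ℚ.* ℚΣ.sum z ∎
    where
    swap : ∀ a b c → a ℚ.* (b ℚ.* c) ≡ b ℚ.* (a ℚ.* c)
    swap = solve 3 (λ a b c → a :* (b :* c) := b :* (a :* c)) refl
    cyc : ∀ a b c → a ℚ.* (b ℚ.* c) ≡ b ℚ.* (c ℚ.* a)
    cyc = solve 3 (λ a b c → a :* (b :* c) := b :* (c :* a)) refl
    transpose : ℚΣ.sum (λ i → ℚΣ.sum (λ j → z i ℚ.* (a i j ℚ.* y j)))
      ≡ ℚΣ.sum (λ j → y j ℚ.* ℚΣ.sum (λ i → a j i ℚ.* z i))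
    transpose = trans (ℚΣ.∑-comm (λ i j → z i ℚ.* (a i j ℚ.* y j))) (ℚΣ.sum-cong-≗ λ j → trans
      (ℚΣ.sum-cong-≗ λ i → trans (cyc (z i) (a i j) (y j))
        (trans (swap (a i j) (y j) (z i)) (cong (λ w → y j ℚ.* (w ℚ.* z i)) (a-sym i j))))
      (sym (ℚΣ.*-distribˡ-sum (y j) (λ i → a j i ℚ.* z i))))

-- A term `c` far along the sequence is within δ of all later ones. Raising it by 6δ overshoots the
-- root, so that p^2 exceeds q, yet leaves p at most 7δ above the later terms.
sqrt-upper : ∀ {x s q} → IsSqrt x s → (∀ m → seq x m ≡ q) → ∀ {δ} → 0ℚ ℚ.< δ →
  ∃[ p ] 0ℚ ℚ.≤ p × q ℚ.< p ℚ.* p × ∃[ N ] ∀ m → N ℕ.≤ m → p ℚ.≤ seq s m ℚ.+ (+ 7 / 1) ℚ.* δ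
sqrt-upper {x} {s} {q} (0≤s , s²≈x) x≡q {δ} 0<δ
  with N₁ , near ← cauchy s δ 0<δ
  with N₂ , square ← s²≈x (δ ℚ.* δ) (*->0 0<δ 0<δ)
  = p , ℚ.≤-trans (ℚ.<⇒≤ 0<δ) δ≤p , q<p² , N₁ , close
  where
  open ℚ-Solver.+-*-Solver
  open ℚ.≤-Reasoning
  0≤δ = ℚ.<⇒≤ 0<δ
  c : ℚ
  c = seq s N₁
  p : ℚ
  -- Since c is at least -2δ, p is at least 4δ. Late terms v satisfy v^2 ≤ (p - δ)^2, and p^2 - (p -
  -- δ)^2 - δ^2 = 2δ(p - δ) is positive.
  p = c ℚ.+ (+ 6 / 1) ℚ.* δ
  near-c : ∀ m → N₁ ℕ.≤ m → ∣ seq s m ℚ.- c ∣ ℚ.≤ δ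
  near-c m N₁≤m = near m N₁ N₁≤m ℕ.≤-refl
  -- Nonnegativity of `s` is the negation of `s < 0`; were c below -2δ, all later terms would be at
  -- most -δ.
  c≥-2δ : ℚ.- ((+ 2 / 1) ℚ.* δ) ℚ.≤ c
  c≥-2δ = ℚ.≮⇒≥ λ c<-2δ → 0≤s (δ , 0<δ , N₁ , λ m N₁≤m → begin
    seq s m ℚ.+ δ
      ≤⟨ ℚ.+-monoˡ-≤ δ (∣-∣≤⇒ˡ (seq s m) c (near-c m N₁≤m)) ⟩
    c ℚ.+ δ ℚ.+ δ
      ≤⟨ ℚ.+-monoˡ-≤ δ (ℚ.+-monoˡ-≤ δ (ℚ.<⇒≤ c<-2δ)) ⟩
    ℚ.- ((+ 2 / 1) ℚ.* δ) ℚ.+ δ ℚ.+ δ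
      ≡⟨ solve 1 (λ d → :- (con (+ 2 / 1) :* d) :+ d :+ d := con 0ℚ) refl δ ⟩
    0ℚ ∎)
  p-4δ≥0 : 0ℚ ℚ.≤ p ℚ.- (+ 4 / 1) ℚ.* δ
  p-4δ≥0 = subst (0ℚ ℚ.≤_)
    (solve 2 (λ c d → c :- (:- (con (+ 2 / 1) :* d))
                   := (c :+ con (+ 6 / 1) :* d) :- con (+ 4 / 1) :* d) refl c δ)
    (difference≥0 c≥-2δ)
  δ≤p : δ ℚ.≤ p
  δ≤p = ≤-from-difference (+-≥0 p-4δ≥0 (+-≥0 0≤δ (+-≥0 0≤δ 0≤δ)))
    (solve 2 (λ p d → (p :- con (+ 4 / 1) :* d) :+ (d :+ (d :+ d)) := p :- d) refl p δ)
  close : ∀ m → N₁ ℕ.≤ m → p ℚ.≤ seq s m ℚ.+ (+ 7 / 1) ℚ.* δ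
  close m N₁≤m = begin
    c ℚ.+ (+ 6 / 1) ℚ.* δ
      ≤⟨ ℚ.+-monoˡ-≤ ((+ 6 / 1) ℚ.* δ) (∣-∣≤⇒ʳ (seq s m) c (near-c m N₁≤m)) ⟩
    seq s m ℚ.+ δ ℚ.+ (+ 6 / 1) ℚ.* δ
      ≡⟨ solve 2 (λ s d → s :+ d :+ con (+ 6 / 1) :* d := s :+ con (+ 7 / 1) :* d) refl (seq s m) δ ⟩
    seq s m ℚ.+ (+ 7 / 1) ℚ.* δ ∎
  q<p² : q ℚ.< p ℚ.* p
  q<p² = begin-strict
    q                                        ≡⟨ x≡q M ⟨
    seq x M                                  ≤⟨ ∣-∣≤⇒ʳ (v ℚ.* v) (seq x M) (square M (ℕ.m≤n⊔m N₁ N₂)) ⟩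
    v ℚ.* v ℚ.+ δ ℚ.* δ                      ≤⟨ ℚ.+-monoˡ-≤ (δ ℚ.* δ) v²≤ ⟩
    (p ℚ.- δ) ℚ.* (p ℚ.- δ) ℚ.+ δ ℚ.* δ      ≡⟨ ℚ.+-identityʳ _ ⟨
    (p ℚ.- δ) ℚ.* (p ℚ.- δ) ℚ.+ δ ℚ.* δ ℚ.+ 0ℚ
      <⟨ ℚ.+-monoʳ-< ((p ℚ.- δ) ℚ.* (p ℚ.- δ) ℚ.+ δ ℚ.* δ) (*->0 (ℚ.+-mono-< 0<δ 0<δ) p-δ>0) ⟩
    (p ℚ.- δ) ℚ.* (p ℚ.- δ) ℚ.+ δ ℚ.* δ ℚ.+ (δ ℚ.+ δ) ℚ.* (p ℚ.- δ)
      ≡⟨ solve 2 (λ p d → (p :- d) :* (p :- d) :+ d :* d :+ (d :+ d) :* (p :- d) := p :* p) refl p δ ⟩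
    p ℚ.* p                                  ∎
    where
    M = N₁ ℕ.⊔ N₂
    v = seq s M
    p-δ>0 : 0ℚ ℚ.< p ℚ.- δ
    p-δ>0 = ℚ.<-≤-trans 0<δ (≤-from-difference (+-≥0 p-4δ≥0 (+-≥0 0≤δ 0≤δ))
      (solve 2 (λ p d → (p :- con (+ 4 / 1) :* d) :+ (d :+ d) := (p :- d) :- d) refl p δ))
    v≤c+δ : v ℚ.≤ c ℚ.+ δ
    v≤c+δ = ∣-∣≤⇒ˡ v c (near-c M (ℕ.m≤m⊔n N₁ N₂))
    c≤v+δ : c ℚ.≤ v ℚ.+ δ
    c≤v+δ = ∣-∣≤⇒ʳ v c (near-c M (ℕ.m≤m⊔n N₁ N₂))
    -- The difference of squares is (p - δ - v)(p - δ + v), each factor written as a sum of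
    -- nonnegative terms.
    v²≤ : v ℚ.* v ℚ.≤ (p ℚ.- δ) ℚ.* (p ℚ.- δ)
    v²≤ = ≤-from-difference
      (*-≥0 (+-≥0 (difference≥0 v≤c+δ) (*-≥0 (ℚ.nonNegative⁻¹ (+ 4 / 1)) 0≤δ))
            (+-≥0 (difference≥0 c≤v+δ) (*-≥0 (ℚ.nonNegative⁻¹ (+ 2 / 1)) (difference≥0 c≥-2δ))))
      (solve 3 (λ c d v → ((c :+ d :- v) :+ con (+ 4 / 1) :* d) :*
                          ((v :+ d :- c) :+ con (+ 2 / 1) :* (c :- (:- (con (+ 2 / 1) :* d))))
                       := (c :+ con (+ 6 / 1) :* d :- d) :* (c :+ con (+ 6 / 1) :* d :- d) :- v :* v)
        refl c δ v)

eventually-all : ∀ {n} {P : Fin n → ℕ → Set} → (∀ i → ∃[ N ] ∀ m → N ℕ.≤ m → P i m) →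
  ∃[ N ] ∀ m → N ℕ.≤ m → ∀ i → P i m
eventually-all {zero}  h = 0 , λ _ _ ()
eventually-all {suc n} h with N , first ← h zero | M , rest ← eventually-all (h ∘ suc) =
  N ℕ.⊔ M , λ where
    m N⊔M≤m zero    → first m (ℕ.m⊔n≤o⇒m≤o N M N⊔M≤m)
    m N⊔M≤m (suc i) → rest m (ℕ.m⊔n≤o⇒n≤o N M N⊔M≤m) i

seq-sum : ∀ {n} (f : Fin n → ℝ) m → seq (sum f) m ≡ ℚΣ.sum (λ i → seq (f i) m)
seq-sum {zero}  f m = refl
seq-sum {suc n} f m = cong (seq (f zero) m ℚ.+_) (seq-sum (f ∘ suc) m)

-- Eigenvalues of the adjacency matrix

module _ {n} (G : Graph n) where
  open Graph G

  seq-adjacency : ∀ i j m → seq (adjacencyMatrix G i j) m ≡ toℚ (g G i j)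
  seq-adjacency i j m with does (i ∼? j)
  ... | true  = refl
  ... | false = refl

  g-sym : ∀ i j → g G i j ≡ g G j i
  g-sym i j = ℕ.≤-antisym (𝟙-mono (i ∼? j) (j ∼? i) symm) (𝟙-mono (j ∼? i) (i ∼? j) symm)

  -- The degrees shifted by t form a vector `z` with a z ≤ r z, since kd + kN + dt ≤ kd + rt + dt =
  -- (k + t)(d + t). Each late index of the Cauchy sequences gives a rational vector obeying the
  -- eigenvalue equation up to δ; `eigenvector-bound` makes its entries arbitrarily small, so `x`
  -- would be zero.
  spectral-bound : ∀ {k N : ℕ} {r t ε : ℚ} {μ : ℝ} →
    (∀ u → ∑ (λ i → g G u i ℕ.* degree G i) ℕ.≤ k ℕ.* degree G u ℕ.+ k ℕ.* N) →
    0ℚ ℚ.< t → r ≡ toℚ k ℚ.+ t → toℚ k ℚ.* toℚ N ℚ.≤ r ℚ.* t →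
    0ℚ ℚ.< ε → (∃[ M ] ∀ m → M ℕ.≤ m → r ℚ.+ ε ℚ.≤ seq μ m) →
    ¬ IsEigenvalue (adjacencyMatrix G) μ
  spectral-bound {k} {N} {r} {t} {ε} {μ} walks 0<t r≡k+t kN≤rt 0<ε (M₀ , above) (x , x≉0 , Ax≈μx) =
    x≉0 λ i η 0<η → vanish i η 0<η
    where
    open ℚ.≤-Reasoning
    open ℚ-Solver.+-*-Solver
    a : Fin n → Fin n → ℚ
    a i j = toℚ (g G i j)
    z : Fin n → ℚ
    z i = toℚ (degree G i) ℚ.+ t
    t≤z : ∀ i → t ℚ.≤ z i
    t≤z i = subst (ℚ._≤ z i) (ℚ.+-identityˡ t) (ℚ.+-monoˡ-≤ t (toℚ≥0 (degree G i)))
    az≤rz : ∀ i → ℚΣ.sum (λ j → a i j ℚ.* z j) ℚ.≤ r ℚ.* z i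
    az≤rz i = begin
      ℚΣ.sum (λ j → a i j ℚ.* (toℚ (degree G j) ℚ.+ t))
        ≡⟨ trans (ℚΣ.sum-cong-≗ λ j → trans (ℚ.*-distribˡ-+ (a i j) (toℚ (degree G j)) t)
                   (cong (ℚ._+ a i j ℚ.* t) (sym (toℚ-* (g G i j) (degree G j)))))
                 (ℚΣ.∑-distrib-+ (λ j → toℚ (g G i j ℕ.* degree G j)) (λ j → a i j ℚ.* t)) ⟩
      ℚΣ.sum (λ j → toℚ (g G i j ℕ.* degree G j)) ℚ.+ ℚΣ.sum (λ j → a i j ℚ.* t)
        ≡⟨ cong₂ ℚ._+_ (sym (toℚ-sum λ j → g G i j ℕ.* degree G j))
             (trans (sym (ℚΣ.*-distribʳ-sum t (a i))) (cong (ℚ._* t) (sym (toℚ-sum (g G i))))) ⟩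
      toℚ (∑ (λ j → g G i j ℕ.* degree G j)) ℚ.+ d ℚ.* t
        ≤⟨ ℚ.+-monoˡ-≤ (d ℚ.* t) (toℚ-mono (walks i)) ⟩
      toℚ (k ℕ.* degree G i ℕ.+ k ℕ.* N) ℚ.+ d ℚ.* t
        ≡⟨ cong (ℚ._+ d ℚ.* t) (trans (toℚ-+ (k ℕ.* degree G i) (k ℕ.* N))
             (cong₂ ℚ._+_ (toℚ-* k (degree G i)) (toℚ-* k N))) ⟩
      toℚ k ℚ.* d ℚ.+ toℚ k ℚ.* toℚ N ℚ.+ d ℚ.* t
        ≤⟨ ℚ.+-monoˡ-≤ (d ℚ.* t) (ℚ.+-monoʳ-≤ (toℚ k ℚ.* d) kN≤rt) ⟩
      toℚ k ℚ.* d ℚ.+ r ℚ.* t ℚ.+ d ℚ.* t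
        ≡⟨ cong (λ r → toℚ k ℚ.* d ℚ.+ r ℚ.* t ℚ.+ d ℚ.* t) r≡k+t ⟩
      toℚ k ℚ.* d ℚ.+ (toℚ k ℚ.+ t) ℚ.* t ℚ.+ d ℚ.* t
        ≡⟨ solve 3 (λ k d t → k :* d :+ (k :+ t) :* t :+ d :* t := (k :+ t) :* (d :+ t)) refl (toℚ k) d t ⟩
      (toℚ k ℚ.+ t) ℚ.* (d ℚ.+ t)
        ≡⟨ cong (ℚ._* (d ℚ.+ t)) r≡k+t ⟨
      r ℚ.* z i ∎
      where d = toℚ (degree G i)
    Z = ℚΣ.sum z
    vanish : ∀ i → x i ≈ 0ℝ
    vanish i η 0<η = Product.map (M₀ ℕ.⊔_) (λ near m M≤m → small m
        (above m (ℕ.m⊔n≤o⇒m≤o M₀ _ M≤m)) (near m (ℕ.m⊔n≤o⇒n≤o M₀ _ M≤m)))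
      (eventually-all λ j → Ax≈μx j δ 0<δ)
      where
      0<Z : 0ℚ ℚ.< Z
      0<Z = ℚ.<-≤-trans 0<t (ℚ.≤-trans (t≤z i) (term≤sum (λ j → ℚ.≤-trans (ℚ.<⇒≤ 0<t) (t≤z j)) i))
      instance
        Z⁺ : Positive Z
        Z⁺ = ℚ.positive 0<Z
        Z≢0 : ℚ.NonZero Z
        Z≢0 = ℚ.pos⇒nonZero Z
        εt⁺ : Positive (ε ℚ.* t)
        εt⁺ = ℚ.positive (*->0 0<ε 0<t)
      -- Chosen with δ Z = ε t η, so that `eigenvector-bound` reads |x i| ≤ η after cancelling ε t.
      δ : ℚ
      δ = ε ℚ.* t ℚ.* η ℚ.* (1/ Z)
      0<δ : 0ℚ ℚ.< δ
      0<δ = *->0 (*->0 (*->0 0<ε 0<t) 0<η) (ℚ.positive⁻¹ (1/ Z) {{ℚ.1/pos⇒pos Z}})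
      δZ : δ ℚ.* Z ≡ ε ℚ.* t ℚ.* η
      δZ = trans (ℚ.*-assoc (ε ℚ.* t ℚ.* η) (1/ Z) Z)
        (trans (cong (ε ℚ.* t ℚ.* η ℚ.*_) (ℚ.*-inverseˡ Z)) (ℚ.*-identityʳ _))
      small : ∀ m → r ℚ.+ ε ℚ.≤ seq μ m →
        (∀ j → ∣ seq ((adjacencyMatrix G · x) j) m ℚ.- seq μ m ℚ.* seq (x j) m ∣ ℚ.≤ δ) →
        ∣ seq (x i) m ℚ.- 0ℚ ∣ ℚ.≤ η
      small m r+ε≤μ near = subst (λ y → ∣ y ∣ ℚ.≤ η) (sym (ℚ.+-identityʳ (seq (x i) m)))
        (ℚ.*-cancelˡ-≤-pos (ε ℚ.* t) (ℚ.≤-trans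
          (eigenvector-bound a z (λ j → seq (x j) m) {r}
            (λ i j → toℚ≥0 (g G i j)) (λ i j → cong toℚ (g-sym i j))
            (ℚ.<⇒≤ 0<t) t≤z az≤rz (ℚ.<⇒≤ 0<ε) r+ε≤μ
            (λ j → subst (λ y → ∣ y ℚ.- seq μ m ℚ.* seq (x j) m ∣ ℚ.≤ δ) (unfold j) (near j)) i)
          (ℚ.≤-reflexive δZ)))
        where
        unfold : ∀ j → seq ((adjacencyMatrix G · x) j) m ≡ ℚΣ.sum (λ l → a j l ℚ.* seq (x l) m)
        unfold j = trans (seq-sum (λ l → adjacencyMatrix G j l * x l) m)
          (ℚΣ.sum-cong-≗ λ l → cong (ℚ._* seq (x l) m) (seq-adjacency j l m))

theorem2 : (k n : ℕ) → 1 ℕ.≤ k → (G : Graph n) →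
    (μ : ℝ) → IsLargestEigenvalue (adjacencyMatrix G) μ →
    (s : ℝ) → IsSqrt (fromℚ (+ (k ℕ.* n) ℚ./ 1) + fromℚ ((+ k ℤ.* + k ℤ.- + 4 ℤ.* + k) ℚ./ 4)) s →
    μ > fromℚ (+ k ℚ./ 2) + s →
    (l : ℕ) → 1 ℕ.≤ l → l ℕ.≤ k → G ⊇ C (2 ℕ.* l ℕ.+ 2)
theorem2 k zero _ G μ ((x , x≉0 , _) , _) _ _ _ _ _ _ = ⊥-elim (x≉0 λ ())
theorem2 k (suc n) _ G μ (μ-eigenvalue , _) s s-sqrt (ε , 0<ε , M , above) l 1≤l l≤k =
  decidable-stable (G ⊇? C (2 ℕ.* l ℕ.+ 2)) λ no-C →
    let p , 0≤p , q<p² , N , p≤s+7δ = sqrt-upper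
          {fromℚ (+ (k ℕ.* suc n) / 1) + fromℚ ((+ k ℤ.* + k ℤ.- + 4 ℤ.* + k) / 4)} {s}
          s-sqrt (λ _ → radicand k n) 0<δ in
    -- With r = k/2 + p and t = p - k/2, the difference r - t is k, and r t = p^2 - (k/2)^2 exceeds
    -- `c`.
    spectral-bound G {k} {n} {h ℚ.+ p} {p ℚ.- h} {δ} {μ} (two-walks no-C)
      (p>h 0≤p q<p²) (r≡k+t p) (kn≤rt q<p²) 0<δ
      (M ℕ.⊔ N , λ m M⊔N≤m → gap p (p≤s+7δ m (ℕ.m⊔n≤o⇒n≤o M N M⊔N≤m)) (above m (ℕ.m⊔n≤o⇒m≤o M N M⊔N≤m)))
      μ-eigenvalue
  where
  open ℚ.≤-Reasoning
  open ℚ-Solver.+-*-Solver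
  h = + k / 2
  -- Of the gap ε below μ, 7δ pays for replacing the root by p, and one δ remains between r and μ.
  δ = (+ 1 / 8) ℚ.* ε
  0<δ : 0ℚ ℚ.< δ
  0<δ = *->0 (ℚ.positive⁻¹ (+ 1 / 8)) 0<ε
  0≤h : 0ℚ ℚ.≤ h
  0≤h = ℚ.nonNegative⁻¹ h {{ℚ.normalize-nonNeg k 2}}
  c = toℚ k ℚ.* toℚ n
  0≤c : 0ℚ ℚ.≤ c
  0≤c = *-≥0 (toℚ≥0 k) (toℚ≥0 n)
  r≡k+t : ∀ p → h ℚ.+ p ≡ toℚ k ℚ.+ (p ℚ.- h)
  r≡k+t p = trans (solve 2 (λ h p → h :+ p := (h :+ h) :+ (p :- h)) refl h p)
    (cong (ℚ._+ (p ℚ.- h)) (half-double k))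
  kn≤rt : ∀ {p} → c ℚ.+ h ℚ.* h ℚ.< p ℚ.* p → c ℚ.≤ (h ℚ.+ p) ℚ.* (p ℚ.- h)
  kn≤rt {p} q<p² = ≤-from-difference (difference≥0 (ℚ.<⇒≤ q<p²))
    (solve 3 (λ c h p → p :* p :- (c :+ h :* h) := (h :+ p) :* (p :- h) :- c) refl c h p)
  p>h : ∀ {p} → 0ℚ ℚ.≤ p → c ℚ.+ h ℚ.* h ℚ.< p ℚ.* p → 0ℚ ℚ.< p ℚ.- h
  -- If p were at most h, then p^2 would be at most h^2, hence at most c + h^2.
  p>h {p} 0≤p q<p² = ℚ.≰⇒> λ p-h≤0 → ℚ.<-irrefl refl (ℚ.<-≤-trans q<p² (≤-from-difference
    (+-≥0 0≤c (*-≥0 (difference≥0 p-h≤0) (+-≥0 0≤h 0≤p)))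
    (solve 3 (λ c h p → c :+ (con 0ℚ :- (p :- h)) :* (h :+ p) := c :+ h :* h :- p :* p) refl c h p)))
  gap : ∀ p {v w} → p ℚ.≤ v ℚ.+ (+ 7 / 1) ℚ.* δ → h ℚ.+ v ℚ.+ ε ℚ.≤ w → h ℚ.+ p ℚ.+ δ ℚ.≤ w
  gap p {v} {w} p≤ ≤w = begin
    h ℚ.+ p ℚ.+ δ
      ≤⟨ ℚ.+-monoˡ-≤ δ (ℚ.+-monoʳ-≤ h p≤) ⟩
    h ℚ.+ (v ℚ.+ (+ 7 / 1) ℚ.* δ) ℚ.+ δ
      ≡⟨ solve 3 (λ h v e → h :+ (v :+ con (+ 7 / 1) :* (con (+ 1 / 8) :* e)) :+ con (+ 1 / 8) :* e
                         := h :+ v :+ e) refl h v ε ⟩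
    h ℚ.+ v ℚ.+ ε
      ≤⟨ ≤w ⟩
    w ∎
  two-walks : ¬ (G ⊇ C (2 ℕ.* l ℕ.+ 2)) → ∀ u →
    ∑ (λ i → g G u i ℕ.* degree G i) ℕ.≤ k ℕ.* degree G u ℕ.+ k ℕ.* n
  two-walks no-C u = ℕ.≤-trans
    (Neighbourhood.two-walks G u l 1≤l
      (λ {x} {xs} w uniq ux uy len → no-C (subst (λ r → G ⊇ C r)
        (trans (cong suc len) (ℕ.+-comm 2 (2 ℕ.* l))) (closed-walk⇒cycle G w uniq ux uy)))
      refl)
    (ℕ.+-mono-≤ (ℕ.*-monoˡ-≤ (degree G u) l≤k) (ℕ.*-monoˡ-≤ n l≤k))
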